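{- For all $k\in\mathbb{N}$, all $\varepsilon\in(0,1)$, all finite groups $(G,+)$ and $(H,\oplus)$, and all functions $f:G\to H$ that are $\varepsilon$-far from being a homomorphism, \[\Pr[\mathsf{RandomSignsTest}_{2k}\text{ rejects } f]\ \ge\ \min\Big\{\frac{(2k-3)\varepsilon}{3},\ \frac{1}{16}\Big\}.\]
   Context: $\mathsf{RandomSignsTest}_k$ (no adversary, direct query access to $f$): draw $x_1,\dots,x_k\in G$ and signs $\sigma_1,\dots,\sigma_k\in\{+,-\}$ independently and uniformly at random; let $a=\sum_{i\in[k]}\sigma_i x_i$; query $f(x_1),\dots,f(x_k),f(a)$; accept iff $\bigoplus_{i\in[k]}\sigma_i f(x_i)=f(a)$, otherwise reject. Here $+b=b$ and $-b$ is the inverse of $b$ (in $G$ or $H$ respectively), and sums are taken in increasing index order (relevant for non-abelian groups). $f$ is $\varepsilon$-far from being a homomorphism if $\Pr_{x\in G}[f(x)\ne h(x)]>\varepsilon$ for every homomorphism $h:G\to H$. -}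

module Defs where

open import Level using (0ℓ)
open import Data.Nat as ℕ using (ℕ; zero; suc)
open import Data.Fin as Fin using (Fin)
open import Data.Bool using (Bool; true; false)
open import Data.List using (List; []; _∷_; [_]; map; concatMap; filter; length; zip; foldl; allFin)
open import Data.Vec as Vec using (Vec)
open import Data.Product using (_×_; _,_)
open import Data.Integer as ℤ using (+_)
open import Data.Rational using (ℚ; 0ℚ; _/_)
open import Relation.Nullary using (¬?)
open import Relation.Binary.PropositionalEquality using (_≡_)
open import Relation.Binary.Definitions using (DecidableEquality)
open import Algebra.Core using (Op₁; Op₂)
open import Algebra.Structures using (IsGroup)
open import Algebra.Bundles.Raw using (RawGroup)
open import Algebra.Morphism.Structures using (module GroupMorphisms)
open import Function.Bundles using (_↔_; Inverse)

record FiniteGroup : Set₁ where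
  field
    Carrier : Set
    _∙_     : Op₂ Carrier
    ε       : Carrier
    _⁻¹     : Op₁ Carrier
    isGroup : IsGroup _≡_ _∙_ ε _⁻¹
    size    : ℕ
    enum    : Fin size ↔ Carrier
    _≟_     : DecidableEquality Carrier

  rawGroup : RawGroup 0ℓ 0ℓ
  rawGroup = record { Carrier = Carrier ; _≈_ = _≡_ ; _∙_ = _∙_ ; ε = ε ; _⁻¹ = _⁻¹ }

  elements : List Carrier
  elements = map (Inverse.to enum) (allFin size)

  signed : Bool → Carrier → Carrier
  signed true  b = b
  signed false b = b ⁻¹

  signedSum : ∀ {m} → Vec Bool m → Vec Carrier m → Carrier
  signedSum σs xs = foldl (λ acc p → acc ∙ signed (Data.Product.proj₁ p) (Data.Product.proj₂ p)) ε
                          (Data.List.zip (Vec.toList σs) (Vec.toList xs))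

IsHomomorphism : (G H : FiniteGroup) → (FiniteGroup.Carrier G → FiniteGroup.Carrier H) → Set
IsHomomorphism G H h = GroupMorphisms.IsGroupHomomorphism (FiniteGroup.rawGroup G) (FiniteGroup.rawGroup H) h

allVecs : {A : Set} → (m : ℕ) → List A → List (Vec A m)
allVecs zero    xs = [ Vec.[] ]
allVecs (suc m) xs = concatMap (λ x → map (x Vec.∷_) (allVecs m xs)) xs

-- the rational a / b (b is never 0 in our uses; 0 returned for b = 0)
frac : ℕ → ℕ → ℚ
frac a zero    = 0ℚ
frac a (suc b) = (+ a) / suc b

disagreement : (G H : FiniteGroup) → (FiniteGroup.Carrier G → FiniteGroup.Carrier H)
             → (FiniteGroup.Carrier G → FiniteGroup.Carrier H) → ℚ
disagreement G H f h =
  frac (length (filter (λ x → ¬? (FiniteGroup._≟_ H (f x) (h x))) (FiniteGroup.elements G)))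
       (FiniteGroup.size G)

εFar : (ε : ℚ) (G H : FiniteGroup) → (FiniteGroup.Carrier G → FiniteGroup.Carrier H) → Set
εFar ε G H f = ∀ (h : FiniteGroup.Carrier G → FiniteGroup.Carrier H) → IsHomomorphism G H h
             → ε Data.Rational.< disagreement G H f h

rejectsOn : (G H : FiniteGroup) (f : FiniteGroup.Carrier G → FiniteGroup.Carrier H)
          → ∀ {m} → Vec (FiniteGroup.Carrier G) m × Vec Bool m → Bool
rejectsOn G H f (xs , σs) =
  Relation.Nullary.does (¬? (FiniteGroup._≟_ H (FiniteGroup.signedSum H σs (Vec.map f xs))
                                              (f (FiniteGroup.signedSum G σs xs))))

rejectProb : (m : ℕ) (G H : FiniteGroup) (f : FiniteGroup.Carrier G → FiniteGroup.Carrier H) → ℚ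
rejectProb m G H f =
  frac (length (filter (λ p → rejectsOn G H f p ≟b true) outcomes))
       (FiniteGroup.size G ℕ.^ m ℕ.* 2 ℕ.^ m)
  where
    open import Data.Bool.Properties using () renaming (_≟_ to _≟b_)
    outcomes : List (Vec (FiniteGroup.Carrier G) m × Vec Bool m)
    outcomes = Data.List.cartesianProduct (allVecs m (FiniteGroup.elements G))
                                          (allVecs m (true ∷ false ∷ []))

{-# OPTIONS --safe #-}
module Submission where

-- * Two runs of the test that differ only in the first sample force f(x y) f(y)⁻¹ to be a constant h(x) for all
--   but a 2ρ fraction of y, where ρ is the rejection probability; as 6ρ < 1, h is a homomorphism.
-- * The inverse of a half run is again a half run (this uses the random signs). Runs on the half products
--   (u, v), (v⁻¹, w) and (u, w) then give f(x) f(y) = f(x y) up to 3ρ, so f is at distance δ ≤ 5ρ from h; feeding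
--   this back into f(x y) = h(x) f(y) improves it to δ ≤ (16/11) ρ.
-- * The probability p_j that a j-sample product violates h satisfies p_{j+1} ≥ p_j + δ (1 - 2 p_j) and
--   p_{2k} ≤ ρ + δ ≤ 1/3. Hence all p_j ≤ 1/3, each step adds δ / 3 or more, and ρ ≥ p_{2k} - δ ≥ (2k - 3) δ / 3.

open import Defs
open import Data.Nat using (ℕ; _*_)
open import Level using (0ℓ)
open import Algebra.Bundles using (Group)
import Algebra.Properties.CommutativeMonoid.Sum as FinSum
import Algebra.Properties.Group as GroupProperties
open import Data.Bool using (Bool; true; false; if_then_else_)
import Data.Bool.Properties as Bool
open import Data.Fin using (Fin; zero; suc)
open import Data.Fin.Properties using (nonZeroIndex)
open import Data.Fin.Permutation using (Permutation′)
open import Data.List using (List; []; _∷_; _++_; map; concatMap; filter; length; foldl; zip; tabulate; allFin; cartesianProduct; cartesianProductWith)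
open import Data.List.Properties using (length-map; length-tabulate)
open import Data.Nat using (zero; suc; _+_; _∸_; _^_; s≤s; z≤n; NonZero; >-nonZero; >-nonZero⁻¹) renaming (_≤_ to _≤ⁿ_; _<_ to _<ⁿ_)
import Data.Nat.Properties as ℕ
open import Algebra.Properties.CommutativeSemigroup ℕ.+-commutativeSemigroup using (interchange)
open import Data.Nat.Tactic.RingSolver using (solve)
open import Data.Product using (∃; _×_; _,_; proj₁; proj₂)
open import Data.Sum using (inj₁; inj₂; [_,_]′)
open import Data.Vec as Vec using (Vec)
open import Function using (_∘_; _↔_; Inverse)
open import Function.Construct.Composition using (_↔-∘_)
open import Function.Construct.Symmetry using (↔-sym)
open import Function.Bundles using (mk↔ₛ′)
open import Relation.Binary.PropositionalEquality
open import Relation.Nullary using (does; yes; no; ¬?; contradiction)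
open import Relation.Unary using (Pred; Decidable)

private
  variable
    A B C : Set

-- Sums of natural numbers over lists.

∑ : List A → (A → ℕ) → ℕ
∑ []       φ = 0
∑ (x ∷ xs) φ = φ x + ∑ xs φ

infix 5 ∑
syntax ∑ xs (λ x → e) = ∑[ x ∈ xs ] e

∑-cong : ∀ (xs : List A) {φ ψ : A → ℕ} → (∀ x → φ x ≡ ψ x) → ∑ xs φ ≡ ∑ xs ψ
∑-cong []       eq = refl
∑-cong (x ∷ xs) eq = cong₂ _+_ (eq x) (∑-cong xs eq)

∑-mono : ∀ (xs : List A) {φ ψ : A → ℕ} → (∀ x → φ x ≤ⁿ ψ x) → ∑ xs φ ≤ⁿ ∑ xs ψ
∑-mono []       le = z≤n
∑-mono (x ∷ xs) le = ℕ.+-mono-≤ (le x) (∑-mono xs le)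

∑-+ : ∀ (xs : List A) (φ ψ : A → ℕ) → (∑[ x ∈ xs ] (φ x + ψ x)) ≡ ∑ xs φ + ∑ xs ψ
∑-+ []       φ ψ = refl
∑-+ (x ∷ xs) φ ψ = begin
  (φ x + ψ x) + (∑[ y ∈ xs ] (φ y + ψ y)) ≡⟨ cong (φ x + ψ x +_) (∑-+ xs φ ψ) ⟩
  (φ x + ψ x) + (∑ xs φ + ∑ xs ψ)         ≡⟨ interchange (φ x) (ψ x) _ _ ⟩
  (φ x + ∑ xs φ) + (ψ x + ∑ xs ψ)         ∎
  where open ≡-Reasoning

∑-const : ∀ (xs : List A) c → (∑[ _ ∈ xs ] c) ≡ length xs * c
∑-const []       c = refl
∑-const (_ ∷ xs) c = cong (c +_) (∑-const xs c)

∑-*ˡ : ∀ (xs : List A) c (φ : A → ℕ) → (∑[ x ∈ xs ] c * φ x) ≡ c * ∑ xs φ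
∑-*ˡ []       c φ = sym (ℕ.*-zeroʳ c)
∑-*ˡ (x ∷ xs) c φ = begin
  c * φ x + (∑[ y ∈ xs ] c * φ y) ≡⟨ cong (c * φ x +_) (∑-*ˡ xs c φ) ⟩
  c * φ x + c * ∑ xs φ            ≡⟨ ℕ.*-distribˡ-+ c (φ x) _ ⟨
  c * (φ x + ∑ xs φ)              ∎
  where open ≡-Reasoning

∑-swap : ∀ (xs : List A) (ys : List B) (φ : A → B → ℕ) →
         (∑[ x ∈ xs ] ∑[ y ∈ ys ] φ x y) ≡ (∑[ y ∈ ys ] ∑[ x ∈ xs ] φ x y)
∑-swap []       ys φ = sym (trans (∑-const ys 0) (ℕ.*-zeroʳ (length ys)))
∑-swap (x ∷ xs) ys φ = begin
  ∑ ys (φ x) + (∑[ x′ ∈ xs ] ∑[ y ∈ ys ] φ x′ y) ≡⟨ cong (∑ ys (φ x) +_) (∑-swap xs ys φ) ⟩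
  ∑ ys (φ x) + (∑[ y ∈ ys ] ∑[ x′ ∈ xs ] φ x′ y) ≡⟨ ∑-+ ys (φ x) _ ⟨
  (∑[ y ∈ ys ] (φ x y + (∑[ x′ ∈ xs ] φ x′ y)))   ∎
  where open ≡-Reasoning

∑-product : ∀ (xs : List A) (ys : List B) (φ : A → ℕ) (ψ : B → ℕ) →
            (∑[ x ∈ xs ] ∑[ y ∈ ys ] φ x * ψ y) ≡ ∑ xs φ * ∑ ys ψ
∑-product xs ys φ ψ = begin
  (∑[ x ∈ xs ] ∑[ y ∈ ys ] φ x * ψ y) ≡⟨ ∑-cong xs (λ x → trans (∑-*ˡ ys (φ x) ψ) (ℕ.*-comm (φ x) _)) ⟩
  (∑[ x ∈ xs ] ∑ ys ψ * φ x)          ≡⟨ ∑-*ˡ xs (∑ ys ψ) φ ⟩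
  ∑ ys ψ * ∑ xs φ                     ≡⟨ ℕ.*-comm (∑ ys ψ) _ ⟩
  ∑ xs φ * ∑ ys ψ                     ∎
  where open ≡-Reasoning

∑-++ : ∀ (xs ys : List A) (φ : A → ℕ) → ∑ (xs ++ ys) φ ≡ ∑ xs φ + ∑ ys φ
∑-++ []       ys φ = refl
∑-++ (x ∷ xs) ys φ = trans (cong (φ x +_) (∑-++ xs ys φ)) (sym (ℕ.+-assoc (φ x) _ _))

∑-map : ∀ (g : A → B) (xs : List A) (φ : B → ℕ) → ∑ (map g xs) φ ≡ ∑ xs (φ ∘ g)
∑-map g []       φ = refl
∑-map g (x ∷ xs) φ = cong (φ (g x) +_) (∑-map g xs φ)

∑-concatMap : ∀ (g : A → List B) (xs : List A) (φ : B → ℕ) →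
              ∑ (concatMap g xs) φ ≡ (∑[ x ∈ xs ] ∑ (g x) φ)
∑-concatMap g []       φ = refl
∑-concatMap g (x ∷ xs) φ = trans (∑-++ (g x) _ φ) (cong (∑ (g x) φ +_) (∑-concatMap g xs φ))

∑-cartesianProductWith : ∀ (g : A → B → C) (xs : List A) (ys : List B) (φ : C → ℕ) →
                         ∑ (cartesianProductWith g xs ys) φ ≡ (∑[ x ∈ xs ] ∑[ y ∈ ys ] φ (g x y))
∑-cartesianProductWith g []       ys φ = refl
∑-cartesianProductWith g (x ∷ xs) ys φ =
  trans (∑-++ (map (g x) ys) _ φ)
        (cong₂ _+_ (∑-map (g x) ys φ) (∑-cartesianProductWith g xs ys φ))

∑-1 : ∀ (xs : List A) → length xs ≡ (∑[ _ ∈ xs ] 1)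
∑-1 xs = sym (trans (∑-const xs 1) (ℕ.*-identityʳ _))

length-cartesianProductWith : ∀ (g : A → B → C) xs ys →
  length (cartesianProductWith g xs ys) ≡ length xs * length ys
length-cartesianProductWith g xs ys = begin
  length (cartesianProductWith g xs ys)  ≡⟨ ∑-1 (cartesianProductWith g xs ys) ⟩
  (∑[ _ ∈ cartesianProductWith g xs ys ] 1) ≡⟨ ∑-cartesianProductWith g xs ys (λ _ → 1) ⟩
  (∑[ _ ∈ xs ] ∑[ _ ∈ ys ] 1)            ≡⟨ ∑-const xs _ ⟩
  length xs * (∑[ _ ∈ ys ] 1)            ≡⟨ cong (length xs *_) (∑-1 ys) ⟨
  length xs * length ys                  ∎
  where open ≡-Reasoning

length-filter-∑ : ∀ {P : Pred A 0ℓ} (P? : Decidable P) (xs : List A) →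
                  length (filter P? xs) ≡ (∑[ x ∈ xs ] (if does (P? x) then 1 else 0))
length-filter-∑ P? []       = refl
length-filter-∑ P? (x ∷ xs) with does (P? x)
... | true  = cong suc (length-filter-∑ P? xs)
... | false = length-filter-∑ P? xs

-- Induction keeps the smaller of the head and the entry found in the tail. This fixes one random
-- choice at a value no worse than the average.
∃≤average : ∀ (xs : List A) (φ : A → ℕ) → 0 <ⁿ length xs → ∃ λ x → length xs * φ x ≤ⁿ ∑ xs φ
∃≤average (x ∷ [])       φ _ = x , ℕ.≤-refl
∃≤average (x ∷ xs@(_ ∷ _)) φ _ with ∃≤average xs φ (s≤s z≤n)
... | y , below with ℕ.≤-total (φ x) (φ y)
...   | inj₁ φx≤φy = x , ℕ.+-monoʳ-≤ (φ x) (ℕ.≤-trans (ℕ.*-monoʳ-≤ (length xs) φx≤φy) below)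
...   | inj₂ φy≤φx = y , ℕ.+-mono-≤ φy≤φx below

open FinSum ℕ.+-0-commutativeMonoid using (sum-permute; sum-cong-≗) renaming (sum to sumFin)

∑-tabulate : ∀ {n} (g : Fin n → A) (φ : A → ℕ) → ∑ (tabulate g) φ ≡ sumFin (φ ∘ g)
∑-tabulate {n = zero}  g φ = refl
∑-tabulate {n = suc n} g φ = cong (φ (g zero) +_) (∑-tabulate (g ∘ suc) φ)

-- Invariance of sums over a finite group, and the indicator of inequality.

group : FiniteGroup → Group 0ℓ 0ℓ
group G = record { isGroup = FiniteGroup.isGroup G }

module _ (G : FiniteGroup) where
  open FiniteGroup G using (elements; size; enum; _≟_)
  open Group (group G) using (Carrier; _∙_; _⁻¹)
  open GroupProperties (group G) using (\\-leftDividesˡ; \\-leftDividesʳ; //-rightDividesˡ; //-rightDividesʳ; ⁻¹-involutive; ⁻¹-injective; ∙-cancelˡ; ∙-cancelʳ)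

  length-elements : length elements ≡ size
  length-elements = trans (length-map (Inverse.to enum) (allFin size)) (length-tabulate _)

  ∑-elements : ∀ φ → ∑ elements φ ≡ sumFin (φ ∘ Inverse.to enum)
  ∑-elements φ = trans (∑-map (Inverse.to enum) (allFin size) φ) (∑-tabulate {n = size} (λ i → i) _)

  ∑-bijection : ∀ (π : Carrier ↔ Carrier) φ → ∑ elements (φ ∘ Inverse.to π) ≡ ∑ elements φ
  ∑-bijection π φ = begin
    ∑ elements (φ ∘ Inverse.to π)                     ≡⟨ ∑-elements _ ⟩
    sumFin (φ ∘ Inverse.to π ∘ to)                    ≡⟨ sum-cong-≗ {n = size}
                                                          (λ i → cong φ (sym (Inverse.strictlyInverseˡ enum _))) ⟩
    sumFin (φ ∘ to ∘ Inverse.to ρ)                    ≡⟨ sum-permute (φ ∘ to) ρ ⟨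
    sumFin (φ ∘ to)                                   ≡⟨ ∑-elements φ ⟨
    ∑ elements φ                                      ∎
    where
    open ≡-Reasoning
    to = Inverse.to enum
    ρ : Permutation′ size
    ρ = ↔-sym enum ↔-∘ (π ↔-∘ enum)

  ∑-translateˡ : ∀ a φ → ∑ elements (φ ∘ (a ∙_)) ≡ ∑ elements φ
  ∑-translateˡ a = ∑-bijection (mk↔ₛ′ (a ∙_) (a ⁻¹ ∙_) (\\-leftDividesˡ a) (\\-leftDividesʳ a))

  ∑-translateʳ : ∀ a φ → ∑ elements (φ ∘ (_∙ a)) ≡ ∑ elements φ
  ∑-translateʳ a = ∑-bijection (mk↔ₛ′ (_∙ a) (_∙ a ⁻¹) (//-rightDividesˡ a) (//-rightDividesʳ a))

  ∑-⁻¹ : ∀ φ → ∑ elements (φ ∘ _⁻¹) ≡ ∑ elements φ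
  ∑-⁻¹ = ∑-bijection (mk↔ₛ′ _⁻¹ _⁻¹ ⁻¹-involutive ⁻¹-involutive)

  -- The form with `does` and `¬?` matches the predicates in `disagreement` and `rejectsOn`, so that
  -- counts there turn into sums of `δ` almost by computation.
  δ : Carrier → Carrier → ℕ
  δ a b = if does (¬? (a ≟ b)) then 1 else 0

  δ-≢ : ∀ {a b} → a ≢ b → δ a b ≡ 1
  δ-≢ {a} {b} a≢b with a ≟ b
  ... | yes a≡b = contradiction a≡b a≢b
  ... | no  _   = refl

  δ-antitone : ∀ {a b c e} → (a ≡ b → c ≡ e) → δ c e ≤ⁿ δ a b
  δ-antitone {a} {b} {c} {e} imp with a ≟ b | c ≟ e
  ... | yes a≡b | no c≢e = contradiction (imp a≡b) c≢e
  ... | yes _   | yes _  = z≤n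
  ... | no _    | yes _  = z≤n
  ... | no _    | no _   = s≤s z≤n

  δ-sym : ∀ a b → δ a b ≡ δ b a
  δ-sym a b = ℕ.≤-antisym (δ-antitone sym) (δ-antitone sym)

  δ-triangle : ∀ a b c → δ a c ≤ⁿ δ a b + δ b c
  δ-triangle a b c with a ≟ b
  ... | yes refl = ℕ.≤-refl
  ... | no  _    with a ≟ c
  ...   | yes _ = z≤n
  ...   | no  _ = s≤s z≤n

  -- Exactly one of a ≠ b and b ≠ c forces a ≠ c.
  δ-xor : ∀ a b c → δ a b + δ b c ≤ⁿ δ a c + 2 * (δ a b * δ b c)
  δ-xor a b c with a ≟ b
  ... | yes refl = ℕ.m≤m+n _ 0
  ... | no a≢b   with b ≟ c
  ...   | yes refl = ℕ.≤-trans (ℕ.≤-reflexive (sym (δ-≢ a≢b))) (ℕ.m≤m+n _ 0)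
  ...   | no  _    = ℕ.m≤n+m 2 _

  δ-∙ˡ : ∀ c a b → δ (c ∙ a) (c ∙ b) ≡ δ a b
  δ-∙ˡ c a b = ℕ.≤-antisym (δ-antitone (cong (c ∙_))) (δ-antitone (∙-cancelˡ c a b))

  δ-∙ʳ : ∀ a b c → δ (a ∙ c) (b ∙ c) ≡ δ a b
  δ-∙ʳ a b c = ℕ.≤-antisym (δ-antitone (cong (_∙ c))) (δ-antitone (∙-cancelʳ c a b))

  δ-⁻¹ : ∀ a b → δ (a ⁻¹) (b ⁻¹) ≡ δ a b
  δ-⁻¹ a b = ℕ.≤-antisym (δ-antitone (cong _⁻¹)) (δ-antitone (⁻¹-injective))

  -- An indicator is 0 or 1, and the value 1 would give `t ≤ c`. Thus a failure bound below 1 on an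
  -- equation without randomness proves the equation.
  δ-small : ∀ {a b c t} → δ a b * t ≤ⁿ c → c <ⁿ t → a ≡ b
  δ-small {a} {b} {c} {t} le lt with a ≟ b
  ... | yes a≡b = a≡b
  ... | no  _   = contradiction (ℕ.≤-trans (ℕ.m≤m+n t 0) le) (ℕ.<⇒≱ lt)

-- Signed random walks in `G × H`.

signs : List Bool
signs = true ∷ false ∷ []

module Walk (G H : FiniteGroup) (f : FiniteGroup.Carrier G → FiniteGroup.Carrier H) where
  private
    module G = Group (group G)
    module H = Group (group H)
    module GP = GroupProperties (group G)
    module HP = GroupProperties (group H)

  open FiniteGroup G using () renaming (elements to E; size to N)

  -- A run is tracked in the direct product of `G` and `H`: the signed sum of the samples next to
  -- that of the answers. The test accepts when the end point lies on the graph of `f`.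
  Point : Set
  Point = G.Carrier × H.Carrier

  _⊗_ : Point → Point → Point
  (u , a) ⊗ (v , b) = u G.∙ v , a H.∙ b

  ⊗-assoc : ∀ p q s → (p ⊗ q) ⊗ s ≡ p ⊗ (q ⊗ s)
  ⊗-assoc p q s = cong₂ _,_ (G.assoc _ _ _) (H.assoc _ _ _)

  inv : Point → Point
  inv (u , a) = u G.⁻¹ , a H.⁻¹

  inv-⊗ : ∀ p q → inv (p ⊗ q) ≡ inv q ⊗ inv p
  inv-⊗ p q = cong₂ _,_ (GP.⁻¹-anti-homo-∙ _ _) (HP.⁻¹-anti-homo-∙ _ _)

  -- g σ z is σ f(σ z): the value contributed by a sample whose signed group element is z.
  g : Bool → G.Carrier → H.Carrier
  g true  z = f z
  g false z = f (z G.⁻¹) H.⁻¹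

  steps : List Point
  steps = cartesianProductWith (λ z σ → z , g σ z) E signs

  -- One entry per outcome of j signed samples: the product of the signed samples and of their signed values.
  walks : ℕ → List Point
  walks zero    = (G.ε , H.ε) ∷ []
  walks (suc j) = cartesianProductWith _⊗_ steps (walks j)

  T : ℕ → ℕ
  T j = (N * 2) ^ j

  length-steps : length steps ≡ N * 2
  length-steps = trans (length-cartesianProductWith _ E signs) (cong (_* 2) (length-elements G))

  length-walks : ∀ j → length (walks j) ≡ T j
  length-walks zero    = refl
  length-walks (suc j) = trans (length-cartesianProductWith _⊗_ steps (walks j))
                               (cong₂ _*_ length-steps (length-walks j))

  instance
    N-nonZero : NonZero N
    N-nonZero = nonZeroIndex (Inverse.from (FiniteGroup.enum G) G.ε)

  T-nonZero : ∀ j → NonZero (T j)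
  T-nonZero j = ℕ.m^n≢0 (N * 2) j {{ℕ.m*n≢0 N 2}}

  ∑-steps : ∀ φ → ∑ steps φ ≡ (∑[ z ∈ E ] ∑[ σ ∈ signs ] φ (z , g σ z))
  ∑-steps = ∑-cartesianProductWith _ E signs

  ∑-walks-suc : ∀ j φ → ∑ (walks (suc j)) φ ≡ (∑[ s ∈ steps ] ∑[ q ∈ walks j ] φ (s ⊗ q))
  ∑-walks-suc j = ∑-cartesianProductWith _⊗_ steps (walks j)

  ∑-walks-suc′ : ∀ j φ → ∑ (walks (suc j)) φ ≡
                 (∑[ z ∈ E ] ∑[ σ ∈ signs ] ∑[ q ∈ walks j ] φ ((z , g σ z) ⊗ q))
  ∑-walks-suc′ j φ = trans (∑-walks-suc j φ) (∑-steps _)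

  ∑-walks-0 : ∀ φ → ∑ (walks 0) φ ≡ φ (G.ε , H.ε)
  ∑-walks-0 φ = ℕ.+-identityʳ _

  ∑-walks-1 : ∀ φ → ∑ (walks 1) φ ≡ ∑ steps φ
  ∑-walks-1 φ = trans (∑-walks-suc 0 φ) (∑-cong steps λ s →
    trans (∑-walks-0 (λ q → φ (s ⊗ q))) (cong φ (cong₂ _,_ (G.identityʳ _) (H.identityʳ _))))

  ∑-walks-+ : ∀ i j φ → ∑ (walks (i + j)) φ ≡ (∑[ p ∈ walks i ] ∑[ q ∈ walks j ] φ (p ⊗ q))
  ∑-walks-+ zero    j φ = sym (trans (∑-walks-0 (λ p → ∑[ q ∈ walks j ] φ (p ⊗ q))) (∑-cong (walks j) λ q →
    cong φ (cong₂ _,_ (G.identityˡ _) (H.identityˡ _))))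
  ∑-walks-+ (suc i) j φ = begin
    ∑ (walks (suc i + j)) φ
      ≡⟨ ∑-walks-suc (i + j) φ ⟩
    (∑[ s ∈ steps ] ∑[ q ∈ walks (i + j) ] φ (s ⊗ q))
      ≡⟨ ∑-cong steps (λ s → ∑-walks-+ i j _) ⟩
    (∑[ s ∈ steps ] ∑[ p ∈ walks i ] ∑[ q ∈ walks j ] φ (s ⊗ (p ⊗ q)))
      ≡⟨ ∑-cong steps (λ s → ∑-cong (walks i) λ p → ∑-cong (walks j) λ q → cong φ (⊗-assoc s p q)) ⟨
    (∑[ s ∈ steps ] ∑[ p ∈ walks i ] ∑[ q ∈ walks j ] φ ((s ⊗ p) ⊗ q))
      ≡⟨ ∑-walks-suc i _ ⟨
    (∑[ p ∈ walks (suc i) ] ∑[ q ∈ walks j ] φ (p ⊗ q)) ∎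
    where open ≡-Reasoning

  -- Here the random signs enter: the inverse of the positive step `(z , f z)` is the negative step
  -- at `z⁻¹`, and conversely. Substituting `z⁻¹` for `z` therefore only exchanges the signs.
  ∑-steps-inv : ∀ φ → ∑ steps (φ ∘ inv) ≡ ∑ steps φ
  ∑-steps-inv φ = begin
    ∑ steps (φ ∘ inv)
      ≡⟨ ∑-steps _ ⟩
    (∑[ z ∈ E ] ∑[ σ ∈ signs ] φ (z G.⁻¹ , g σ z H.⁻¹))
      ≡⟨ ∑-⁻¹ G (λ z → ∑[ σ ∈ signs ] φ (z G.⁻¹ , g σ z H.⁻¹)) ⟨
    (∑[ z ∈ E ] ∑[ σ ∈ signs ] φ (z G.⁻¹ G.⁻¹ , g σ (z G.⁻¹) H.⁻¹))
      ≡⟨ ∑-cong E swapSigns ⟩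
    (∑[ z ∈ E ] ∑[ σ ∈ signs ] φ (z , g σ z))
      ≡⟨ ∑-steps φ ⟨
    ∑ steps φ ∎
    where
    open ≡-Reasoning
    swapSigns : ∀ z → (∑[ σ ∈ signs ] φ (z G.⁻¹ G.⁻¹ , g σ (z G.⁻¹) H.⁻¹)) ≡ (∑[ σ ∈ signs ] φ (z , g σ z))
    swapSigns z rewrite GP.⁻¹-involutive z | HP.⁻¹-involutive (f z) = begin
      φ (z , f (z G.⁻¹) H.⁻¹) + (φ (z , f z) + 0) ≡⟨ cong (φ (z , f (z G.⁻¹) H.⁻¹) +_) (ℕ.+-identityʳ _) ⟩
      φ (z , f (z G.⁻¹) H.⁻¹) + φ (z , f z)       ≡⟨ ℕ.+-comm (φ (z , f (z G.⁻¹) H.⁻¹)) _ ⟩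
      φ (z , f z) + φ (z , f (z G.⁻¹) H.⁻¹)       ≡⟨ cong (φ (z , f z) +_) (ℕ.+-identityʳ _) ⟨
      φ (z , f z) + (φ (z , f (z G.⁻¹) H.⁻¹) + 0) ∎

  -- Inversion reverses the factors, so the inverted first step ends up last; cutting a walk of
  -- `j + 1` steps before its last step restores the form of a walk.
  ∑-walks-inv : ∀ j φ → ∑ (walks j) (φ ∘ inv) ≡ ∑ (walks j) φ
  ∑-walks-inv zero    φ = cong (λ p → φ p + 0) (cong₂ _,_ GP.ε⁻¹≈ε HP.ε⁻¹≈ε)
  ∑-walks-inv (suc j) φ = begin
    ∑ (walks (suc j)) (φ ∘ inv)
      ≡⟨ ∑-walks-suc j _ ⟩
    (∑[ s ∈ steps ] ∑[ q ∈ walks j ] φ (inv (s ⊗ q)))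
      ≡⟨ ∑-cong steps (λ s → trans (∑-cong (walks j) λ q → cong φ (inv-⊗ s q)) (∑-walks-inv j (λ q → φ (q ⊗ inv s)))) ⟩
    (∑[ s ∈ steps ] ∑[ q ∈ walks j ] φ (q ⊗ inv s))
      ≡⟨ ∑-swap steps (walks j) _ ⟩
    (∑[ q ∈ walks j ] ∑[ s ∈ steps ] φ (q ⊗ inv s))
      ≡⟨ ∑-cong (walks j) (λ q → trans (∑-steps-inv (λ s → φ (q ⊗ s))) (sym (∑-walks-1 _))) ⟩
    (∑[ q ∈ walks j ] ∑[ s ∈ walks 1 ] φ (q ⊗ s))
      ≡⟨ ∑-walks-+ j 1 φ ⟨
    ∑ (walks (j + 1)) φ
      ≡⟨ cong (λ i → ∑ (walks i) φ) (ℕ.+-comm j 1) ⟩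
    ∑ (walks (suc j)) φ ∎
    where open ≡-Reasoning

  -- The first step alone makes the end point uniform, whatever the later steps are, because
  -- translations permute the group. Hence at least one step is required.
  ∑-walks-translate : ∀ j a (ψ : G.Carrier → ℕ) →
    N * (∑[ q ∈ walks (suc j) ] ψ (a G.∙ proj₁ q)) ≡ T (suc j) * ∑ E ψ
  ∑-walks-translate j a ψ = begin
    N * (∑[ q ∈ walks (suc j) ] ψ (a G.∙ proj₁ q))
      ≡⟨ cong (N *_) (trans (∑-walks-suc j _) (∑-swap steps (walks j) _)) ⟩
    N * (∑[ q ∈ walks j ] ∑[ s ∈ steps ] ψ (a G.∙ (proj₁ s G.∙ proj₁ q)))
      ≡⟨ cong (N *_) (trans (∑-cong (walks j) firstStep) (∑-const (walks j) _)) ⟩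
    N * (length (walks j) * (2 * ∑ E ψ))
      ≡⟨ cong (λ l → N * (l * (2 * ∑ E ψ))) (length-walks j) ⟩
    N * (T j * (2 * ∑ E ψ))
      ≡⟨ rearrange N (T j) (∑ E ψ) ⟩
    T (suc j) * ∑ E ψ ∎
    where
    open ≡-Reasoning
    rearrange : ∀ n t e → n * (t * (2 * e)) ≡ n * 2 * t * e
    rearrange n t e = solve (n ∷ t ∷ e ∷ [])
    firstStep : ∀ q → (∑[ s ∈ steps ] ψ (a G.∙ (proj₁ s G.∙ proj₁ q))) ≡ 2 * ∑ E ψ
    firstStep q = begin
      (∑[ s ∈ steps ] ψ (a G.∙ (proj₁ s G.∙ proj₁ q)))       ≡⟨ ∑-steps _ ⟩
      (∑[ z ∈ E ] 2 * ψ (a G.∙ (z G.∙ proj₁ q)))              ≡⟨ ∑-*ˡ E 2 _ ⟩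
      2 * (∑[ z ∈ E ] ψ (a G.∙ (z G.∙ proj₁ q)))              ≡⟨ cong (2 *_) (∑-translateʳ G (proj₁ q) (λ z → ψ (a G.∙ z))) ⟩
      2 * (∑[ z ∈ E ] ψ (a G.∙ z))                            ≡⟨ cong (2 *_) (∑-translateˡ G a ψ) ⟩
      2 * ∑ E ψ ∎

  -- `r m / T m` is the rejection probability ρ, as `rejectProb≡` confirms.
  r : ℕ → ℕ
  r m = ∑[ p ∈ walks m ] δ H (proj₂ p) (f (proj₁ p))

  -- Two m-step walks that differ only in the first step, x z against z, yield f(x y) f(y)⁻¹ = c with c
  -- depending on that step alone while y depends on the remaining steps.
  popular : ∀ {m} → 2 ≤ⁿ m → ∀ x → ∃ λ c →
            T m * (∑[ y ∈ E ] δ H (f (x G.∙ y)) (c H.∙ f y)) ≤ⁿ 2 * (r m * N)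
  -- `m ≥ 2` leaves at least one step after the first, so the rest of the walk makes `y` uniform.
  popular {suc (suc j)} (s≤s (s≤s z≤n)) x = c , (begin
    N * 2 * T (suc j) * φ c       ≡⟨ rearrange (N * 2) (T (suc j)) (φ c) ⟩
    T (suc j) * (N * 2 * φ c)     ≡⟨ cong (λ l → T (suc j) * (l * φ c)) length-candidates ⟨
    T (suc j) * (length candidates * φ c) ≤⟨ ℕ.*-monoʳ-≤ (T (suc j)) below ⟩
    T (suc j) * ∑ candidates φ    ≤⟨ total ⟩
    N * (R + R)                   ≡⟨ double N R ⟩
    2 * (R * N)                   ∎)
    where
    open ℕ.≤-Reasoning
    R = r (suc (suc j))
    W = walks (suc j)
    -- The value of `f(x y) f(y)⁻¹` forced when the walks with first steps `x z` and `z` both pass: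
    -- the rest of the walk is common to both and cancels.
    Q : G.Carrier → Bool → H.Carrier
    Q z σ = g σ (x G.∙ z) H.∙ g σ z H.⁻¹
    candidates = cartesianProductWith Q E signs
    φ : H.Carrier → ℕ
    φ c = ∑[ y ∈ E ] δ H (f (x G.∙ y)) (c H.∙ f y)
    length-candidates : length candidates ≡ N * 2
    length-candidates = trans (length-cartesianProductWith Q E signs) (cong (_* 2) (length-elements G))
    rearrange : ∀ n t e → n * t * e ≡ t * (n * e)
    rearrange n t e = solve (n ∷ t ∷ e ∷ [])
    double : ∀ n e → n * (e + e) ≡ 2 * (e * n)
    double n e = solve (n ∷ e ∷ [])
    -- On average over `z` and `σ` the candidate `Q z σ` fails for at most a fraction 2ρ of the `y`;
    -- some candidate does no worse.
    best = ∃≤average candidates φ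
      (subst (0 <ⁿ_) (sym length-candidates) (ℕ.*-monoˡ-< 2 (>-nonZero⁻¹ N)))
    c = proj₁ best
    below = proj₂ best
    fails : G.Carrier → Bool → Point → ℕ
    fails z σ q = δ H (g σ z H.∙ proj₂ q) (f (z G.∙ proj₁ q))
    misses : G.Carrier → Bool → Point → ℕ
    misses z σ q = δ H (f (x G.∙ (z G.∙ proj₁ q))) (Q z σ H.∙ f (z G.∙ proj₁ q))
    pointwise : ∀ z σ q → misses z σ q ≤ⁿ fails (x G.∙ z) σ q + fails z σ q
    pointwise z σ (u , a) = begin
      δ H (f (x G.∙ (z G.∙ u))) (Q z σ H.∙ f (z G.∙ u))
        ≤⟨ δ-triangle H _ (g σ (x G.∙ z) H.∙ a) _ ⟩
      δ H (f (x G.∙ (z G.∙ u))) (g σ (x G.∙ z) H.∙ a) + δ H (g σ (x G.∙ z) H.∙ a) (Q z σ H.∙ f (z G.∙ u))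
        ≡⟨ cong₂ _+_ (trans (δ-sym H _ _) (cong (λ w → δ H (g σ (x G.∙ z) H.∙ a) (f w)) (sym (G.assoc x z u))))
                     (trans (cong (λ b → δ H b (Q z σ H.∙ f (z G.∙ u))) Q∙) (δ-∙ˡ H (Q z σ) _ _)) ⟩
      fails (x G.∙ z) σ (u , a) + fails z σ (u , a) ∎
      where
      Q∙ : g σ (x G.∙ z) H.∙ a ≡ Q z σ H.∙ (g σ z H.∙ a)
      Q∙ = trans (cong (H._∙ a) (sym (HP.//-rightDividesˡ (g σ z) _))) (H.assoc _ _ _)
    total : T (suc j) * ∑ candidates φ ≤ⁿ N * (R + R)
    total = begin
      T (suc j) * ∑ candidates φ
        ≡⟨ cong (T (suc j) *_) (∑-cartesianProductWith Q E signs φ) ⟩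
      T (suc j) * (∑[ z ∈ E ] ∑[ σ ∈ signs ] φ (Q z σ))
        ≡⟨ trans (∑-cong E λ z → ∑-*ˡ signs (T (suc j)) (λ σ → φ (Q z σ))) (∑-*ˡ E (T (suc j)) _) ⟨
      (∑[ z ∈ E ] ∑[ σ ∈ signs ] T (suc j) * φ (Q z σ))
        ≡⟨ ∑-cong E (λ z → ∑-cong signs λ σ → ∑-walks-translate j z (λ y → δ H (f (x G.∙ y)) (Q z σ H.∙ f y))) ⟨
      (∑[ z ∈ E ] ∑[ σ ∈ signs ] N * (∑ W (misses z σ)))
        ≡⟨ trans (∑-cong E λ z → ∑-*ˡ signs N (λ σ → ∑ W (misses z σ))) (∑-*ˡ E N _) ⟩
      N * (∑[ z ∈ E ] ∑[ σ ∈ signs ] ∑ W (misses z σ))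
        ≤⟨ ℕ.*-monoʳ-≤ N (∑-mono E λ z → ∑-mono signs λ σ → ∑-mono W (pointwise z σ)) ⟩
      N * (∑[ z ∈ E ] ∑[ σ ∈ signs ] ∑[ q ∈ W ] (fails (x G.∙ z) σ q + fails z σ q))
        ≡⟨ cong (N *_) (trans
             (∑-cong E λ z → trans (∑-cong signs λ σ → ∑-+ W (fails (x G.∙ z) σ) (fails z σ))
                                   (∑-+ signs (λ σ → ∑ W (fails (x G.∙ z) σ)) (λ σ → ∑ W (fails z σ))))
             (∑-+ E (λ z → ∑[ σ ∈ signs ] ∑ W (fails (x G.∙ z) σ)) (λ z → ∑[ σ ∈ signs ] ∑ W (fails z σ)))) ⟩
      N * ((∑[ z ∈ E ] ∑[ σ ∈ signs ] ∑ W (fails (x G.∙ z) σ)) + (∑[ z ∈ E ] ∑[ σ ∈ signs ] ∑ W (fails z σ)))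
        -- As `z` runs over the group so does `x z`; both walks are distributed as a test run and
        -- each fails `R` times in total.
        ≡⟨ cong (λ s → N * (s + (∑[ z ∈ E ] ∑[ σ ∈ signs ] ∑ W (fails z σ)))) (∑-translateˡ G x (λ z → ∑[ σ ∈ signs ] ∑ W (fails z σ))) ⟩
      N * ((∑[ z ∈ E ] ∑[ σ ∈ signs ] ∑ W (fails z σ)) + (∑[ z ∈ E ] ∑[ σ ∈ signs ] ∑ W (fails z σ)))
        ≡⟨ cong (λ s → N * (s + s)) (∑-walks-suc′ (suc j) (λ p → δ H (proj₂ p) (f (proj₁ p)))) ⟨
      N * (R + R) ∎

-- The decoded homomorphism and its distance from `f`.

module Decoded (G H : FiniteGroup) (f : FiniteGroup.Carrier G → FiniteGroup.Carrier H)
               (h : FiniteGroup.Carrier G → FiniteGroup.Carrier H) where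
  private
    module G = Group (group G)
    module H = Group (group H)
    module GP = GroupProperties (group G)
    module HP = GroupProperties (group H)

  open FiniteGroup G using () renaming (elements to E; size to N)
  open Walk G H f

  -- With ρ = `r m / T m`: for every `x`, the equation `f(x y) = h(x) f(y)` fails for at most a
  -- fraction 2ρ of the `y`.
  Popular : ℕ → Set
  Popular m = ∀ x → T m * (∑[ y ∈ E ] δ H (f (x G.∙ y)) (h x H.∙ f y)) ≤ⁿ 2 * (r m * N)

  ∑E-const : ∀ c → (∑[ _ ∈ E ] c) ≡ N * c
  ∑E-const c = trans (∑-const E c) (cong (_* c) (length-elements G))

  Homo : Set
  Homo = ∀ x y → h (x G.∙ y) ≡ h x H.∙ h y

  -- Expand `f(x y z)` once through `h(x y)` and once through `h(x)` and `h(y)`. A violation would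
  -- make one of three equations fail at every `z`, while each fails for at most a fraction 2ρ of
  -- them and 6ρ < 1.
  popular⇒homo : ∀ m → Popular m → 6 * r m <ⁿ T m → Homo
  popular⇒homo m close small x y = δ-small H {c = 6 * r m} (ℕ.*-cancelʳ-≤ _ _ N (begin
    Δ * T m * N
      ≡⟨ rearrange Δ (T m) N ⟩
    T m * (N * Δ)
      ≡⟨ cong (T m *_) (∑E-const Δ) ⟨
    T m * (∑[ _ ∈ E ] Δ)
      ≤⟨ ℕ.*-monoʳ-≤ (T m) (∑-mono E pointwise) ⟩
    T m * (∑[ z ∈ E ] (misses (x G.∙ y) z + (misses x (y G.∙ z) + misses y z)))
      ≡⟨ cong (T m *_) (trans (∑-+ E _ _) (cong (∑ E (misses (x G.∙ y)) +_) (∑-+ E _ _))) ⟩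
    T m * (∑ E (misses (x G.∙ y)) + (∑ E (misses x ∘ (y G.∙_)) + ∑ E (misses y)))
      ≡⟨ cong (λ s → T m * (∑ E (misses (x G.∙ y)) + (s + ∑ E (misses y)))) (∑-translateˡ G y (misses x)) ⟩
    T m * (∑ E (misses (x G.∙ y)) + (∑ E (misses x) + ∑ E (misses y)))
      ≡⟨ trans (ℕ.*-distribˡ-+ (T m) _ _) (cong (T m * ∑ E (misses (x G.∙ y)) +_) (ℕ.*-distribˡ-+ (T m) _ _)) ⟩
    T m * ∑ E (misses (x G.∙ y)) + (T m * ∑ E (misses x) + T m * ∑ E (misses y))
      ≤⟨ ℕ.+-mono-≤ (close (x G.∙ y)) (ℕ.+-mono-≤ (close x) (close y)) ⟩
    2 * (r m * N) + (2 * (r m * N) + 2 * (r m * N))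
      ≡⟨ sixfold (r m) N ⟩
    6 * r m * N ∎)) small
    where
    open ℕ.≤-Reasoning
    Δ = δ H (h (x G.∙ y)) (h x H.∙ h y)
    misses : G.Carrier → G.Carrier → ℕ
    misses x z = δ H (f (x G.∙ z)) (h x H.∙ f z)
    rearrange : ∀ a b c → a * b * c ≡ b * (c * a)
    rearrange a b c = solve (a ∷ b ∷ c ∷ [])
    sixfold : ∀ a b → 2 * (a * b) + (2 * (a * b) + 2 * (a * b)) ≡ 6 * a * b
    sixfold a b = solve (a ∷ b ∷ [])
    pointwise : ∀ z → Δ ≤ⁿ misses (x G.∙ y) z + (misses x (y G.∙ z) + misses y z)
    pointwise z = begin
      Δ
        ≡⟨ δ-∙ʳ H _ _ (f z) ⟨
      δ H (h (x G.∙ y) H.∙ f z) (h x H.∙ h y H.∙ f z)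
        ≤⟨ δ-triangle H _ (f (x G.∙ y G.∙ z)) _ ⟩
      δ H (h (x G.∙ y) H.∙ f z) (f (x G.∙ y G.∙ z)) + δ H (f (x G.∙ y G.∙ z)) (h x H.∙ h y H.∙ f z)
        ≡⟨ cong₂ _+_ (δ-sym H _ _) (cong₂ (δ H) (cong f (G.assoc x y z)) (H.assoc _ _ _)) ⟩
      misses (x G.∙ y) z + δ H (f (x G.∙ (y G.∙ z))) (h x H.∙ (h y H.∙ f z))
        ≤⟨ ℕ.+-monoʳ-≤ (misses (x G.∙ y) z) (δ-triangle H _ (h x H.∙ f (y G.∙ z)) _) ⟩
      misses (x G.∙ y) z + (misses x (y G.∙ z) + δ H (h x H.∙ f (y G.∙ z)) (h x H.∙ (h y H.∙ f z)))
        ≡⟨ cong (λ e → misses (x G.∙ y) z + (misses x (y G.∙ z) + e)) (δ-∙ˡ H (h x) _ _) ⟩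
      misses (x G.∙ y) z + (misses x (y G.∙ z) + misses y z) ∎

  module _ (homo : Homo) where

    homo-ε : h G.ε ≡ H.ε
    homo-ε = HP.identityˡ-unique _ (h G.ε) (trans (sym (homo G.ε G.ε)) (cong h (G.identityˡ G.ε)))

    homo-⁻¹ : ∀ x → h (x G.⁻¹) ≡ h x H.⁻¹
    homo-⁻¹ x = HP.inverseˡ-unique _ _ (trans (sym (homo _ x)) (trans (cong h (G.inverseˡ x)) homo-ε))

    isHomomorphism : IsHomomorphism G H h
    isHomomorphism = record
      { isMonoidHomomorphism = record
        { isMagmaHomomorphism = record
          { isRelHomomorphism = record { cong = cong h }
          ; homo = homo
          }
        ; ε-homo = homo-ε
        }
      ; ⁻¹-homo = homo-⁻¹
      }

  b : G.Carrier → ℕ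
  b x = δ H (f x) (h x)

  -- `bad / N` is the distance between `f` and `h`, called δ in the bounds below.
  bad : ℕ
  bad = ∑ E b

  -- The test on p ⊗ q, inv q ⊗ s and p ⊗ s: since the walks are closed under inv, all three are uniform,
  -- and together they give f(x) f(y) = f(x y) at a uniform pair (x , y).
  popular⇒near : ∀ i → Popular (suc i + suc i) →
                 T (suc i + suc i) * bad ≤ⁿ 5 * (r (suc i + suc i) * N)
  popular⇒near i close = ℕ.*-cancelˡ-≤ (M * M * M) {{ℕ.m*n≢0 (M * M) M {{ℕ.m*n≢0 M M}}}} (begin
    M * M * M * (T m * bad)
      ≡⟨ e₁ M (T m) bad ⟩
    T m * (M * (M * (M * bad)))
      ≡⟨ cong (T m *_) sumΔ ⟨
    T m * (N * (∑[ p ∈ W ] ∑[ q ∈ W ] ∑[ _ ∈ W ] b (proj₁ p G.∙ proj₁ q)))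
      ≤⟨ ℕ.*-monoʳ-≤ (T m) (ℕ.*-monoʳ-≤ N (∑-mono W λ p → ∑-mono W λ q → ∑-mono W λ s → pointwise p q s)) ⟩
    T m * (N * (∑[ p ∈ W ] ∑[ q ∈ W ] ∑[ s ∈ W ] (X p q s + Y p q s)))
      ≡⟨ cong (λ e → T m * (N * e)) (trans
           (∑-cong W λ p → trans (∑-cong W λ q → ∑-+ W (X p q) (Y p q)) (∑-+ W _ _)) (∑-+ W _ _)) ⟩
    T m * (N * ((∑[ p ∈ W ] ∑[ q ∈ W ] ∑ W (X p q)) + (∑[ p ∈ W ] ∑[ q ∈ W ] ∑ W (Y p q))))
      ≡⟨ cong (λ e → T m * (N * (e + (∑[ p ∈ W ] ∑[ q ∈ W ] ∑ W (Y p q))))) sumX ⟩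
    T m * (N * (M * R + (M * R + M * R) + (∑[ p ∈ W ] ∑[ q ∈ W ] ∑ W (Y p q))))
      ≡⟨ e₂ (T m) N (M * R) _ ⟩
    T m * (N * (3 * (M * R))) + T m * (N * (∑[ p ∈ W ] ∑[ q ∈ W ] ∑ W (Y p q)))
      ≤⟨ ℕ.+-monoʳ-≤ _ sumY ⟩
    T m * (N * (3 * (M * R))) + M * (M * (M * (2 * (R * N))))
      ≡⟨ cong (λ t → t * (N * (3 * (M * R))) + M * (M * (M * (2 * (R * N))))) (ℕ.^-distribˡ-+-* (N * 2) k k) ⟩
    M * M * (N * (3 * (M * R))) + M * (M * (M * (2 * (R * N))))
      ≡⟨ e₃ M N R ⟩
    M * M * M * (5 * (R * N)) ∎)
    where
    open ℕ.≤-Reasoning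
    k = suc i
    m = k + k
    W = walks k
    M = T k
    R = r m
    instance
      M-nonZero : NonZero M
      M-nonZero = T-nonZero k
    ∑W-const : ∀ c → (∑[ _ ∈ W ] c) ≡ M * c
    ∑W-const c = trans (∑-const W c) (cong (_* c) (length-walks k))
    e : Point → ℕ
    e p = δ H (proj₂ p) (f (proj₁ p))
    -- `X` counts failures of the three tests, `Y` a failure of the popular equation at `x = u v`,
    -- `y = v⁻¹ w`.
    X Y : Point → Point → Point → ℕ
    X p q s = e (p ⊗ q) + (e (inv q ⊗ s) + e (p ⊗ s))
    ψ : Point → Point → G.Carrier → ℕ
    ψ p q y = δ H (f (proj₁ p G.∙ proj₁ q G.∙ y)) (h (proj₁ p G.∙ proj₁ q) H.∙ f y)
    Y p q s = ψ p q (proj₁ q G.⁻¹ G.∙ proj₁ s)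
    e₁ : ∀ M T c → M * M * M * (T * c) ≡ T * (M * (M * (M * c)))
    e₁ M T c = solve (M ∷ T ∷ c ∷ [])
    e₂ : ∀ T N c d → T * (N * (c + (c + c) + d)) ≡ T * (N * (3 * c)) + T * (N * d)
    e₂ T N c d = solve (T ∷ N ∷ c ∷ d ∷ [])
    e₃ : ∀ M N R → M * M * (N * (3 * (M * R))) + M * (M * (M * (2 * (R * N)))) ≡ M * M * M * (5 * (R * N))
    e₃ M N R = solve (M ∷ N ∷ R ∷ [])
    -- Without failures `f(u v) f(v⁻¹ w) = f(u w) = h(u v) f(v⁻¹ w)`, and cancelling leaves `f(u v)
    -- = h(u v)`. The costs 3ρ and 2ρ make up the factor 5.
    pointwise : ∀ p q s → b (proj₁ p G.∙ proj₁ q) ≤ⁿ X p q s + Y p q s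
    pointwise p@(u , α) q@(v , β) s@(w , γ) = begin
      δ H (f (u G.∙ v)) (h (u G.∙ v))
        ≡⟨ δ-∙ʳ H _ _ (f v⁻¹w) ⟨
      δ H (f (u G.∙ v) H.∙ f v⁻¹w) (h (u G.∙ v) H.∙ f v⁻¹w)
        ≤⟨ δ-triangle H _ (f (u G.∙ w)) _ ⟩
      δ H (f (u G.∙ v) H.∙ f v⁻¹w) (f (u G.∙ w)) + δ H (f (u G.∙ w)) (h (u G.∙ v) H.∙ f v⁻¹w)
        ≡⟨ cong (λ t → δ H (f (u G.∙ v) H.∙ f v⁻¹w) (f (u G.∙ w)) + δ H (f t) (h (u G.∙ v) H.∙ f v⁻¹w)) uw ⟩
      δ H (f (u G.∙ v) H.∙ f v⁻¹w) (f (u G.∙ w)) + Y p q s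
        ≤⟨ ℕ.+-monoˡ-≤ (Y p q s) (δ-triangle H _ (α H.∙ β H.∙ f v⁻¹w) _) ⟩
      δ H (f (u G.∙ v) H.∙ f v⁻¹w) (α H.∙ β H.∙ f v⁻¹w) + δ H (α H.∙ β H.∙ f v⁻¹w) (f (u G.∙ w)) + Y p q s
        ≤⟨ ℕ.+-monoˡ-≤ (Y p q s) (ℕ.+-monoʳ-≤ _ (δ-triangle H _ (α H.∙ γ) _)) ⟩
      δ H (f (u G.∙ v) H.∙ f v⁻¹w) (α H.∙ β H.∙ f v⁻¹w) + (δ H (α H.∙ β H.∙ f v⁻¹w) (α H.∙ γ) + e (p ⊗ s)) + Y p q s
        ≡⟨ cong (_+ Y p q s) (cong₂ _+_
             (trans (δ-∙ʳ H _ _ (f v⁻¹w)) (δ-sym H _ _))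
             (cong (_+ e (p ⊗ s)) (trans (cong (δ H (α H.∙ β H.∙ f v⁻¹w)) αγ)
                                         (trans (δ-∙ˡ H (α H.∙ β) _ _) (δ-sym H _ _))))) ⟩
      X p q s + Y p q s ∎
      where
      v⁻¹w = v G.⁻¹ G.∙ w
      uw : u G.∙ w ≡ u G.∙ v G.∙ v⁻¹w
      uw = trans (cong (u G.∙_) (sym (GP.\\-leftDividesˡ v w))) (sym (G.assoc u v _))
      αγ : α H.∙ γ ≡ α H.∙ β H.∙ (β H.⁻¹ H.∙ γ)
      αγ = trans (cong (α H.∙_) (sym (HP.\\-leftDividesˡ β γ))) (sym (H.assoc α β _))
    sumΔ : N * (∑[ p ∈ W ] ∑[ q ∈ W ] ∑[ _ ∈ W ] b (proj₁ p G.∙ proj₁ q)) ≡ M * (M * (M * bad))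
    sumΔ = begin-equality
      N * (∑[ p ∈ W ] ∑[ q ∈ W ] ∑[ _ ∈ W ] b (proj₁ p G.∙ proj₁ q))
        ≡⟨ ∑-*ˡ W N _ ⟨
      (∑[ p ∈ W ] N * (∑[ q ∈ W ] ∑[ _ ∈ W ] b (proj₁ p G.∙ proj₁ q)))
        ≡⟨ ∑-cong W (λ p → cong (N *_) (∑-swap W W _)) ⟩
      (∑[ p ∈ W ] N * (∑[ _ ∈ W ] ∑[ q ∈ W ] b (proj₁ p G.∙ proj₁ q)))
        ≡⟨ ∑-cong W (λ p → trans (sym (∑-*ˡ W N _)) (∑-cong W λ _ → ∑-walks-translate i (proj₁ p) b)) ⟩
      (∑[ _ ∈ W ] ∑[ _ ∈ W ] M * bad)
        ≡⟨ trans (∑W-const _) (cong (M *_) (∑W-const _)) ⟩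
      M * (M * (M * bad)) ∎
    R≡ : (∑[ p ∈ W ] ∑[ q ∈ W ] e (p ⊗ q)) ≡ R
    R≡ = sym (∑-walks-+ k k e)
    sumX : (∑[ p ∈ W ] ∑[ q ∈ W ] ∑ W (X p q)) ≡ M * R + (M * R + M * R)
    sumX = begin-equality
      (∑[ p ∈ W ] ∑[ q ∈ W ] ∑ W (X p q))
        ≡⟨ ∑-cong W (λ p → ∑-cong W λ q → trans (∑-+ W _ _) (cong₂ _+_ (∑W-const (e (p ⊗ q))) (∑-+ W _ _))) ⟩
      (∑[ p ∈ W ] ∑[ q ∈ W ] (M * e (p ⊗ q) + ((∑[ s ∈ W ] e (inv q ⊗ s)) + (∑[ s ∈ W ] e (p ⊗ s)))))
        -- Invariance under inversion turns the sum over `inv q` into one over `q`, so the middle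
        -- test fails as often as the other two.
        ≡⟨ ∑-cong W (λ p → trans (∑-+ W _ _) (cong₂ _+_ (∑-*ˡ W M _) (trans (∑-+ W _ _)
             (cong₂ _+_ (∑-walks-inv k (λ q → ∑[ s ∈ W ] e (q ⊗ s))) (∑W-const _))))) ⟩
      (∑[ p ∈ W ] (M * (∑[ q ∈ W ] e (p ⊗ q)) + ((∑[ q ∈ W ] ∑[ s ∈ W ] e (q ⊗ s)) + M * (∑[ s ∈ W ] e (p ⊗ s)))))
        ≡⟨ trans (∑-+ W _ _) (cong₂ _+_ (∑-*ˡ W M _) (trans (∑-+ W _ _) (cong₂ _+_ (∑W-const _) (∑-*ˡ W M _)))) ⟩
      M * (∑[ p ∈ W ] ∑[ q ∈ W ] e (p ⊗ q)) + (M * (∑[ p ∈ W ] ∑[ q ∈ W ] e (p ⊗ q)) + M * (∑[ p ∈ W ] ∑[ q ∈ W ] e (p ⊗ q)))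
        ≡⟨ cong (λ t → M * t + (M * t + M * t)) R≡ ⟩
      M * R + (M * R + M * R) ∎
    -- For fixed `p` and `q` the element `v⁻¹ w` is uniform, since `w` ends a nonempty walk.
    boundY : ∀ p q → T m * (N * ∑ W (Y p q)) ≤ⁿ M * (2 * (R * N))
    boundY p q = begin
      T m * (N * ∑ W (Y p q))  ≡⟨ cong (T m *_) (∑-walks-translate i (proj₁ q G.⁻¹) (ψ p q)) ⟩
      T m * (M * ∑ E (ψ p q))  ≡⟨ e₄ (T m) M _ ⟩
      M * (T m * ∑ E (ψ p q))  ≤⟨ ℕ.*-monoʳ-≤ M (close _) ⟩
      M * (2 * (R * N))        ∎
      where
      e₄ : ∀ a b c → a * (b * c) ≡ b * (a * c)
      e₄ a b c = solve (a ∷ b ∷ c ∷ [])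
    sumY : T m * (N * (∑[ p ∈ W ] ∑[ q ∈ W ] ∑ W (Y p q))) ≤ⁿ M * (M * (M * (2 * (R * N))))
    sumY = begin
      T m * (N * (∑[ p ∈ W ] ∑[ q ∈ W ] ∑ W (Y p q)))
        ≡⟨ trans (∑-*ˡ W (T m) _) (cong (T m *_) (∑-*ˡ W N _)) ⟨
      (∑[ p ∈ W ] T m * (N * (∑[ q ∈ W ] ∑ W (Y p q))))
        ≡⟨ ∑-cong W (λ p → trans (∑-*ˡ W (T m) _) (cong (T m *_) (∑-*ˡ W N _))) ⟨
      (∑[ p ∈ W ] ∑[ q ∈ W ] T m * (N * ∑ W (Y p q)))
        ≤⟨ ∑-mono W (λ p → ∑-mono W λ q → boundY p q) ⟩
      (∑[ p ∈ W ] ∑[ q ∈ W ] M * (2 * (R * N)))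
        ≡⟨ trans (∑W-const _) (cong (M *_) (∑W-const _)) ⟩
      M * (M * (M * (2 * (R * N)))) ∎

  module _ (homo : Homo) where

    -- Where `f(x y) = h(x) f(y)`, the maps `f` and `h` agree at `x y` exactly when they agree at
    -- `y`. As `x y` and `y` are independent and uniform, exactly one disagreement has probability
    -- 2δ(1 - δ), whence δ(1 - δ) ≤ ρ; the quadratic term stands on the right to avoid subtraction.
    popular⇒quadratic : ∀ m → Popular m →
      T m * (N * bad + N * bad) ≤ⁿ N * (2 * (r m * N)) + T m * (2 * (bad * bad))
    popular⇒quadratic m close = begin
      T m * (N * bad + N * bad)
        ≡⟨ cong (T m *_) sumLeft ⟨
      T m * (∑[ x ∈ E ] ∑[ y ∈ E ] (b (x G.∙ y) + b y))
        ≤⟨ ℕ.*-monoʳ-≤ (T m) (∑-mono E λ x → ∑-mono E λ y → pointwise x y) ⟩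
      T m * (∑[ x ∈ E ] ∑[ y ∈ E ] (misses x y + 2 * (b (x G.∙ y) * b y)))
        ≡⟨ cong (T m *_) (trans (∑-cong E λ x → ∑-+ E (misses x) _) (∑-+ E _ _)) ⟩
      T m * ((∑[ x ∈ E ] ∑ E (misses x)) + (∑[ x ∈ E ] ∑[ y ∈ E ] 2 * (b (x G.∙ y) * b y)))
        ≡⟨ trans (ℕ.*-distribˡ-+ (T m) _ _) (cong₂ _+_ (sym (∑-*ˡ E (T m) _)) (cong (T m *_) sumRight)) ⟩
      (∑[ x ∈ E ] T m * ∑ E (misses x)) + T m * (2 * (bad * bad))
        ≤⟨ ℕ.+-monoˡ-≤ _ (∑-mono E close) ⟩
      (∑[ x ∈ E ] 2 * (r m * N)) + T m * (2 * (bad * bad))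
        ≡⟨ cong (_+ T m * (2 * (bad * bad))) (∑E-const _) ⟩
      N * (2 * (r m * N)) + T m * (2 * (bad * bad)) ∎
      where
      open ℕ.≤-Reasoning
      misses : G.Carrier → G.Carrier → ℕ
      misses x y = δ H (f (x G.∙ y)) (h x H.∙ f y)
      pointwise : ∀ x y → b (x G.∙ y) + b y ≤ⁿ misses x y + 2 * (b (x G.∙ y) * b y)
      pointwise x y = subst (λ c → b (x G.∙ y) + c ≤ⁿ misses x y + 2 * (b (x G.∙ y) * c))
        (trans (cong (λ a → δ H a (h x H.∙ f y)) (homo x y)) (trans (δ-∙ˡ H (h x) _ _) (δ-sym H _ _)))
        (δ-xor H (f (x G.∙ y)) (h (x G.∙ y)) (h x H.∙ f y))
      sumLeft : (∑[ x ∈ E ] ∑[ y ∈ E ] (b (x G.∙ y) + b y)) ≡ N * bad + N * bad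
      sumLeft = begin-equality
        (∑[ x ∈ E ] ∑[ y ∈ E ] (b (x G.∙ y) + b y))
          ≡⟨ ∑-cong E (λ x → trans (∑-+ E _ b) (cong (_+ bad) (∑-translateˡ G x b))) ⟩
        (∑[ x ∈ E ] (bad + bad))
          ≡⟨ trans (∑E-const _) (ℕ.*-distribˡ-+ N bad bad) ⟩
        N * bad + N * bad ∎
      sumRight : (∑[ x ∈ E ] ∑[ y ∈ E ] 2 * (b (x G.∙ y) * b y)) ≡ 2 * (bad * bad)
      sumRight = begin-equality
        (∑[ x ∈ E ] ∑[ y ∈ E ] 2 * (b (x G.∙ y) * b y))
          ≡⟨ trans (∑-cong E λ x → ∑-*ˡ E 2 _) (∑-*ˡ E 2 _) ⟩
        2 * (∑[ x ∈ E ] ∑[ y ∈ E ] b (x G.∙ y) * b y)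
          ≡⟨ cong (2 *_) (∑-swap E E _) ⟩
        2 * (∑[ y ∈ E ] ∑[ x ∈ E ] b (x G.∙ y) * b y)
          ≡⟨ cong (2 *_) (∑-cong E λ y → ∑-translateʳ G y (λ x → b x * b y)) ⟩
        2 * (∑[ y ∈ E ] ∑[ x ∈ E ] b x * b y)
          ≡⟨ cong (2 *_) (trans (∑-swap E E _) (∑-product E E b b)) ⟩
        2 * (bad * bad) ∎

    β : Point → ℕ
    β p = δ H (proj₂ p) (h (proj₁ p))

    P : ℕ → ℕ
    P j = ∑ (walks j) β

    -- A negative step at `z` violates `h` exactly when `f` and `h` differ at `z⁻¹`, because `h`
    -- respects inverses; so each sign contributes `bad`.
    ∑-steps-β : ∑ steps β ≡ 2 * bad
    ∑-steps-β = begin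
      ∑ steps β                                              ≡⟨ ∑-steps β ⟩
      (∑[ z ∈ E ] (b z + (δ H (f (z G.⁻¹) H.⁻¹) (h z) + 0))) ≡⟨ ∑-cong E (λ z → cong (λ e → b z + (e + 0)) (negative z)) ⟩
      (∑[ z ∈ E ] (b z + (b (z G.⁻¹) + 0)))                  ≡⟨ ∑-cong E (λ z → cong (b z +_) (ℕ.+-identityʳ _)) ⟩
      (∑[ z ∈ E ] (b z + b (z G.⁻¹)))                        ≡⟨ trans (∑-+ E b _) (cong (bad +_) (∑-⁻¹ G b)) ⟩
      bad + bad                                              ≡⟨ cong (bad +_) (ℕ.+-identityʳ bad) ⟨
      2 * bad                                                ∎
      where
      open ≡-Reasoning
      negative : ∀ z → δ H (f (z G.⁻¹) H.⁻¹) (h z) ≡ b (z G.⁻¹)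
      negative z = trans (cong (δ H _) (trans (sym (HP.⁻¹-involutive _)) (cong H._⁻¹ (sym (homo-⁻¹ homo z)))))
                         (δ-⁻¹ H _ _)

    -- A violation in exactly one of the new step and the rest, which are independent, makes the
    -- product violate `h`. With p_j = `P j / T j`, division by `T (suc j)` gives p_{j+1} ≥ p_j + δ
    -- - 2δp_j.
    P-suc : ∀ j → N * 2 * P j + 2 * bad * T j ≤ⁿ P (suc j) + 2 * (2 * bad * P j)
    P-suc j = begin
      N * 2 * P j + 2 * bad * T j
        ≡⟨ cong₂ _+_ (cong (_* P j) length-steps) (cong₂ _*_ ∑-steps-β (length-walks j)) ⟨
      length steps * P j + ∑ steps β * length W
        ≡⟨ trans (ℕ.+-comm (length steps * P j) _) (cong (_+ length steps * P j) (ℕ.*-comm (∑ steps β) (length W))) ⟩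
      length W * ∑ steps β + length steps * P j
        ≡⟨ trans (∑-+ steps _ _) (cong₂ _+_ (∑-*ˡ steps (length W) β) (∑-const steps (P j))) ⟨
      (∑[ s ∈ steps ] (length W * β s + P j))
        ≡⟨ ∑-cong steps (λ s → trans (∑-+ W _ β) (cong (_+ P j) (∑-const W (β s)))) ⟨
      (∑[ s ∈ steps ] ∑[ q ∈ W ] (β s + β q))
        ≤⟨ ∑-mono steps (λ s → ∑-mono W λ q → pointwise s q) ⟩
      (∑[ s ∈ steps ] ∑[ q ∈ W ] (β (s ⊗ q) + 2 * (β s * β q)))
        ≡⟨ trans (∑-cong steps λ s → trans (∑-+ W _ _) (cong ((∑[ q ∈ W ] β (s ⊗ q)) +_) (∑-*ˡ W 2 _))) (∑-+ steps _ _) ⟩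
      (∑[ s ∈ steps ] ∑[ q ∈ W ] β (s ⊗ q)) + (∑[ s ∈ steps ] 2 * (∑[ q ∈ W ] β s * β q))
        ≡⟨ cong₂ _+_ (sym (∑-walks-suc j β)) (trans (∑-*ˡ steps 2 _) (cong (2 *_) (∑-product steps W β β))) ⟩
      P (suc j) + 2 * (∑ steps β * P j)
        ≡⟨ cong (λ e → P (suc j) + 2 * (e * P j)) ∑-steps-β ⟩
      P (suc j) + 2 * (2 * bad * P j) ∎
      where
      open ℕ.≤-Reasoning
      W = walks j
      pointwise : ∀ s q → β s + β q ≤ⁿ β (s ⊗ q) + 2 * (β s * β q)
      pointwise (u , a) (v , c) = begin
        δ H a (h u) + δ H c (h v)
          ≡⟨ cong₂ _+_ (δ-∙ʳ H a (h u) c) (δ-∙ˡ H (h u) c (h v)) ⟨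
        δ H (a H.∙ c) (h u H.∙ c) + δ H (h u H.∙ c) (h u H.∙ h v)
          ≤⟨ δ-xor H _ (h u H.∙ c) _ ⟩
        δ H (a H.∙ c) (h u H.∙ h v) + 2 * (δ H (a H.∙ c) (h u H.∙ c) * δ H (h u H.∙ c) (h u H.∙ h v))
          ≡⟨ cong₂ (λ d e → δ H (a H.∙ c) d + 2 * e) (sym (homo u v)) (cong₂ _*_ (δ-∙ʳ H a (h u) c) (δ-∙ˡ H (h u) c (h v))) ⟩
        δ H (a H.∙ c) (h (u G.∙ v)) + 2 * (δ H a (h u) * δ H c (h v)) ∎

    -- A walk that violates `h` is rejected by the test or ends where `f` and `h` differ. Its end
    -- point is uniform, so p_m ≤ ρ + δ for m ≥ 1.
    P-upper : ∀ j → N * P (suc j) ≤ⁿ N * r (suc j) + T (suc j) * bad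
    P-upper j = begin
      N * P (suc j)
        ≤⟨ ℕ.*-monoʳ-≤ N (∑-mono W λ p → δ-triangle H _ (f (proj₁ p)) _) ⟩
      N * (∑[ p ∈ W ] (δ H (proj₂ p) (f (proj₁ p)) + b (proj₁ p)))
        ≡⟨ trans (cong (N *_) (∑-+ W _ _)) (ℕ.*-distribˡ-+ N _ _) ⟩
      N * r (suc j) + N * (∑[ p ∈ W ] b (proj₁ p))
        ≡⟨ cong (λ e → N * r (suc j) + N * e) (∑-cong W λ p → cong b (G.identityˡ (proj₁ p))) ⟨
      N * r (suc j) + N * (∑[ p ∈ W ] b (G.ε G.∙ proj₁ p))
        ≡⟨ cong (N * r (suc j) +_) (∑-walks-translate j G.ε b) ⟩
      N * r (suc j) + T (suc j) * bad ∎
      where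
      open ℕ.≤-Reasoning
      W = walks (suc j)

-- Outcomes of the test as walks.

module Counting (G H : FiniteGroup) (f : FiniteGroup.Carrier G → FiniteGroup.Carrier H) where
  private
    module G = Group (group G)
    module H = Group (group H)

  open FiniteGroup G using () renaming (elements to E; size to N; signed to signedG)
  open FiniteGroup H using () renaming (signed to signedH)
  open Walk G H f
  open ≡-Reasoning

  -- The test draws a sample and a sign, whereas a step is indexed by the signed element; replacing
  -- `x` by `x⁻¹` in the negative half converts one into the other.
  ∑-signed : ∀ (φ : Point → ℕ) → (∑[ x ∈ E ] ∑[ σ ∈ signs ] φ (signedG σ x , signedH σ (f x))) ≡ ∑ steps φ
  ∑-signed φ = begin
    (∑[ x ∈ E ] (φ (x , f x) + (φ (x G.⁻¹ , f x H.⁻¹) + 0)))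
      ≡⟨ ∑-+ E (λ x → φ (x , f x)) _ ⟩
    (∑[ x ∈ E ] φ (x , f x)) + (∑[ x ∈ E ] (φ (x G.⁻¹ , f x H.⁻¹) + 0))
      ≡⟨ cong ((∑[ x ∈ E ] φ (x , f x)) +_) (∑-⁻¹ G (λ x → φ (x G.⁻¹ , f x H.⁻¹) + 0)) ⟨
    (∑[ x ∈ E ] φ (x , f x)) + (∑[ x ∈ E ] (φ (x G.⁻¹ G.⁻¹ , f (x G.⁻¹) H.⁻¹) + 0))
      ≡⟨ cong ((∑[ x ∈ E ] φ (x , f x)) +_) (∑-cong E λ x →
           cong (λ z → φ (z , f (x G.⁻¹) H.⁻¹) + 0) (GroupProperties.⁻¹-involutive (group G) x)) ⟩
    (∑[ x ∈ E ] φ (x , f x)) + (∑[ x ∈ E ] (φ (x , f (x G.⁻¹) H.⁻¹) + 0))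
      ≡⟨ ∑-+ E (λ x → φ (x , f x)) _ ⟨
    (∑[ x ∈ E ] ∑[ σ ∈ signs ] φ (x , g σ x))
      ≡⟨ ∑-steps φ ⟨
    ∑ steps φ ∎

  -- The fold of `signedSum` with a free starting value, for the induction in `∑-evaluate`.
  signedSumFrom : ∀ (K : FiniteGroup) → FiniteGroup.Carrier K →
                  ∀ {m} → Vec Bool m → Vec (FiniteGroup.Carrier K) m → FiniteGroup.Carrier K
  signedSumFrom K a σs xs = foldl (λ acc p → K ._∙_ acc (signed K (proj₁ p) (proj₂ p))) a
                                  (zip (Vec.toList σs) (Vec.toList xs))
    where open FiniteGroup

  evaluate : Point → ∀ {m} → Vec G.Carrier m → Vec Bool m → Point
  evaluate p xs σs = signedSumFrom G (proj₁ p) σs xs , signedSumFrom H (proj₂ p) σs (Vec.map f xs)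

  ∑-evaluate : ∀ m p (φ : Point → ℕ) →
    (∑[ xs ∈ allVecs m E ] ∑[ σs ∈ allVecs m signs ] φ (evaluate p xs σs)) ≡ (∑[ q ∈ walks m ] φ (p ⊗ q))
  ∑-evaluate zero    p φ = trans (ℕ.+-identityʳ _) (cong (λ q → φ q + 0)
    (cong₂ _,_ (sym (G.identityʳ _)) (sym (H.identityʳ _))))
  ∑-evaluate (suc m) p φ = begin
    (∑[ xs ∈ allVecs (suc m) E ] ∑[ σs ∈ allVecs (suc m) signs ] φ (evaluate p xs σs))
      ≡⟨ ∑-allVecs E _ ⟩
    (∑[ x ∈ E ] ∑[ xs ∈ allVecs m E ] ∑[ σs ∈ allVecs (suc m) signs ] φ (evaluate p (x Vec.∷ xs) σs))
      ≡⟨ ∑-cong E (λ x → ∑-cong (allVecs m E) λ xs → ∑-allVecs signs (λ σs → φ (evaluate p (x Vec.∷ xs) σs))) ⟩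
    (∑[ x ∈ E ] ∑[ xs ∈ allVecs m E ] ∑[ σ ∈ signs ] ∑[ σs ∈ allVecs m signs ] φ (evaluate (p ⊗ step x σ) xs σs))
      -- All samples are listed before all signs; the swap brings the first sign next to its sample.
      ≡⟨ ∑-cong E (λ x → ∑-swap (allVecs m E) signs (λ xs σ → ∑[ σs ∈ allVecs m signs ] φ (evaluate (p ⊗ step x σ) xs σs))) ⟩
    (∑[ x ∈ E ] ∑[ σ ∈ signs ] ∑[ xs ∈ allVecs m E ] ∑[ σs ∈ allVecs m signs ] φ (evaluate (p ⊗ step x σ) xs σs))
      ≡⟨ ∑-cong E (λ x → ∑-cong signs λ σ → ∑-evaluate m (p ⊗ step x σ) φ) ⟩
    (∑[ x ∈ E ] ∑[ σ ∈ signs ] ∑[ q ∈ walks m ] φ ((p ⊗ step x σ) ⊗ q))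
      ≡⟨ ∑-signed (λ s → ∑[ q ∈ walks m ] φ ((p ⊗ s) ⊗ q)) ⟩
    (∑[ s ∈ steps ] ∑[ q ∈ walks m ] φ ((p ⊗ s) ⊗ q))
      ≡⟨ ∑-cong steps (λ s → ∑-cong (walks m) λ q → cong φ (⊗-assoc p s q)) ⟩
    (∑[ s ∈ steps ] ∑[ q ∈ walks m ] φ (p ⊗ (s ⊗ q)))
      ≡⟨ ∑-walks-suc m (λ q → φ (p ⊗ q)) ⟨
    (∑[ q ∈ walks (suc m) ] φ (p ⊗ q)) ∎
    where
    step : G.Carrier → Bool → Point
    step x σ = signedG σ x , signedH σ (f x)
    ∑-allVecs : ∀ {A : Set} (xs : List A) (ψ : Vec A (suc m) → ℕ) →
      ∑ (allVecs (suc m) xs) ψ ≡ (∑[ x ∈ xs ] ∑[ v ∈ allVecs m xs ] ψ (x Vec.∷ v))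
    ∑-allVecs xs ψ = trans (∑-concatMap (λ x → map (x Vec.∷_) (allVecs m xs)) xs ψ)
                           (∑-cong xs λ x → ∑-map (x Vec.∷_) (allVecs m xs) ψ)

  rejectProb≡ : ∀ m → rejectProb m G H f ≡ frac (r m) (T m)
  rejectProb≡ m = cong₂ frac rejections (sym (^-distribʳ-* m))
    where
    does-≟-true : ∀ c → does (c Bool.≟ true) ≡ c
    does-≟-true true  = refl
    does-≟-true false = refl
    ^-distribʳ-* : ∀ m → (N * 2) ^ m ≡ N ^ m * 2 ^ m
    ^-distribʳ-* zero    = refl
    ^-distribʳ-* (suc m) = trans (cong (N * 2 *_) (^-distribʳ-* m)) (rearrange N (N ^ m) (2 ^ m))
      where
      rearrange : ∀ a b c → a * 2 * (b * c) ≡ a * b * (2 * c)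
      rearrange a b c = solve (a ∷ b ∷ c ∷ [])
    rejections : length (filter (λ p → rejectsOn G H f p Bool.≟ true)
                                (cartesianProduct (allVecs m E) (allVecs m signs))) ≡ r m
    rejections = begin
      _ ≡⟨ length-filter-∑ (λ p → rejectsOn G H f p Bool.≟ true) (cartesianProduct (allVecs m E) (allVecs m signs)) ⟩
      (∑[ p ∈ cartesianProduct (allVecs m E) (allVecs m signs) ] (if does (rejectsOn G H f p Bool.≟ true) then 1 else 0))
        ≡⟨ ∑-cartesianProductWith _,_ (allVecs m E) (allVecs m signs) _ ⟩
      (∑[ xs ∈ allVecs m E ] ∑[ σs ∈ allVecs m signs ] (if does (rejectsOn G H f (xs , σs) Bool.≟ true) then 1 else 0))
        ≡⟨ ∑-cong (allVecs m E) (λ xs → ∑-cong (allVecs m signs) λ σs →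
             cong (λ c → if c then 1 else 0) (does-≟-true (rejectsOn G H f (xs , σs)))) ⟩
      (∑[ xs ∈ allVecs m E ] ∑[ σs ∈ allVecs m signs ] e (evaluate (G.ε , H.ε) xs σs))
        ≡⟨ ∑-evaluate m (G.ε , H.ε) e ⟩
      (∑[ q ∈ walks m ] e ((G.ε , H.ε) ⊗ q))
        ≡⟨ ∑-cong (walks m) (λ q → cong e (cong₂ _,_ (G.identityˡ _) (H.identityˡ _))) ⟩
      r m ∎
      where
      e : Point → ℕ
      e p = δ H (proj₂ p) (f (proj₁ p))

-- Inequalities between the counts.

module Arithmetic where
  open ℕ.≤-Reasoning

  -- δ ≤ 5ρ ≤ 5/16 keeps 1 - δ away from 0 in `distance-fine`.
  distance-crude : ∀ N T r b .{{_ : NonZero T}} → 16 * r ≤ⁿ T → T * b ≤ⁿ 5 * (r * N) → 16 * b ≤ⁿ 5 * N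
  distance-crude N T r b 16r≤T near = ℕ.*-cancelˡ-≤ T (begin
    T * (16 * b)       ≡⟨ e₁ T b ⟩
    16 * (T * b)       ≤⟨ ℕ.*-monoʳ-≤ 16 near ⟩
    16 * (5 * (r * N)) ≡⟨ e₂ r N ⟩
    16 * r * (5 * N)   ≤⟨ ℕ.*-monoˡ-≤ (5 * N) 16r≤T ⟩
    T * (5 * N)        ∎)
    where
    e₁ : ∀ T b → T * (16 * b) ≡ 16 * (T * b)
    e₁ T b = solve (T ∷ b ∷ [])
    e₂ : ∀ r N → 16 * (5 * (r * N)) ≡ 16 * r * (5 * N)
    e₂ r N = solve (r ∷ N ∷ [])

  -- As δ ≤ 5/16, the factor 1 - δ in δ(1 - δ) ≤ ρ is at least 11/16. The term `T * (5 * N * b)`,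
  -- added on both sides, replaces a subtraction.
  distance-fine : ∀ N T r b .{{_ : NonZero N}} → 16 * b ≤ⁿ 5 * N →
                  T * (N * b + N * b) ≤ⁿ N * (2 * (r * N)) + T * (2 * (b * b)) →
                  11 * (T * b) ≤ⁿ 16 * (r * N)
  distance-fine N T r b crude exact = ℕ.*-cancelˡ-≤ N (ℕ.+-cancelʳ-≤ (T * (5 * N * b)) _ _ (begin
    N * (11 * (T * b)) + T * (5 * N * b)         ≡⟨ e₁ N T b ⟩
    8 * (T * (N * b + N * b))                    ≤⟨ ℕ.*-monoʳ-≤ 8 exact ⟩
    8 * (N * (2 * (r * N)) + T * (2 * (b * b)))  ≡⟨ e₂ N T r b ⟩
    N * (16 * (r * N)) + T * (16 * b * b)        ≤⟨ ℕ.+-monoʳ-≤ _ (ℕ.*-monoʳ-≤ T (ℕ.*-monoˡ-≤ b crude)) ⟩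
    N * (16 * (r * N)) + T * (5 * N * b)         ∎))
    where
    e₁ : ∀ N T b → N * (11 * (T * b)) + T * (5 * N * b) ≡ 8 * (T * (N * b + N * b))
    e₁ N T b = solve (N ∷ T ∷ b ∷ [])
    e₂ : ∀ N T r b → 8 * (N * (2 * (r * N)) + T * (2 * (b * b))) ≡ N * (16 * (r * N)) + T * (16 * b * b)
    e₂ N T r b = solve (N ∷ T ∷ r ∷ b ∷ [])

  -- Inserting δ ≤ (16/11)ρ gives 3(ρ + δ) ≤ (81/11)ρ, which 16ρ ≤ 1 keeps below 1.
  third-bound : ∀ N T r b → 16 * r ≤ⁿ T → 11 * (T * b) ≤ⁿ 16 * (r * N) → 3 * (N * r + T * b) ≤ⁿ N * T
  third-bound N T r b 16r≤T fine = ℕ.*-cancelˡ-≤ 11 (begin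
    11 * (3 * (N * r + T * b))                        ≡⟨ e₁ N T r b ⟩
    33 * (r * N) + 3 * (11 * (T * b))                 ≤⟨ ℕ.+-monoʳ-≤ (33 * (r * N)) (ℕ.*-monoʳ-≤ 3 fine) ⟩
    -- The coefficient 81 is raised to 96 = 6 * 16 so that 16ρ ≤ 1 applies.
    33 * (r * N) + 3 * (16 * (r * N))                 ≤⟨ ℕ.m≤m+n _ (15 * (r * N)) ⟩
    33 * (r * N) + 3 * (16 * (r * N)) + 15 * (r * N)  ≡⟨ e₂ N r ⟩
    6 * (16 * r * N)                                  ≤⟨ ℕ.*-monoʳ-≤ 6 (ℕ.*-monoˡ-≤ N 16r≤T) ⟩
    6 * (T * N)                                       ≤⟨ ℕ.*-monoˡ-≤ (T * N) (ℕ.m≤m+n 6 5) ⟩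
    11 * (T * N)                                      ≡⟨ cong (11 *_) (ℕ.*-comm T N) ⟩
    11 * (N * T)                                      ∎)
    where
    e₁ : ∀ N T r b → 11 * (3 * (N * r + T * b)) ≡ 33 * (r * N) + 3 * (11 * (T * b))
    e₁ N T r b = solve (N ∷ T ∷ r ∷ b ∷ [])
    e₂ : ∀ N r → 33 * (r * N) + 3 * (16 * (r * N)) + 15 * (r * N) ≡ 6 * (16 * r * N)
    e₂ N r = solve (N ∷ r ∷ [])

  -- Write p for P / T and δ for b / N. The recursion p′ ≥ p + δ (1 - 2 p) makes 1 - 2 p shrink at every step,
  -- so p ≤ 1/3 at the end means p ≤ 1/3 throughout, and then every step adds at least δ / 3.
  module _ (N b c : ℕ) .{{_ : NonZero c}} (N≡ : N ≡ 2 * b + c) (P : ℕ → ℕ)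
           (P-suc : ∀ j → N * 2 * P j + 2 * b * (N * 2) ^ j ≤ⁿ P (suc j) + 2 * (2 * b * P j)) where
    private
      T : ℕ → ℕ
      T j = (N * 2) ^ j

    -- By the recursion (1 - 2δ)p_j ≤ p_{j+1} - δ ≤ 1/3 - δ ≤ (1 - 2δ)/3. Since `c` is `N - 2b`, its
    -- being nonzero means 1 - 2δ > 0 and permits the division.
    third-pred : ∀ j → 3 * P (suc j) ≤ⁿ T (suc j) → 3 * P j ≤ⁿ T j
    third-pred j le = ℕ.*-cancelˡ-≤ (2 * c) {{ℕ.m*n≢0 2 c}} (ℕ.+-cancelˡ-≤ (12 * (b * P j) + 4 * (b * T j)) _ _ (begin
      12 * (b * P j) + 4 * (b * T j) + 2 * c * (3 * P j)
        ≤⟨ ℕ.m≤m+n _ (2 * (b * T j)) ⟩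
      12 * (b * P j) + 4 * (b * T j) + 2 * c * (3 * P j) + 2 * (b * T j)
        ≡⟨ e₁ b c (P j) (T j) ⟩
      3 * ((2 * b + c) * 2 * P j + 2 * b * T j)
        ≡⟨ cong (λ n → 3 * (n * 2 * P j + 2 * b * T j)) N≡ ⟨
      3 * (N * 2 * P j + 2 * b * T j)
        ≤⟨ ℕ.*-monoʳ-≤ 3 (P-suc j) ⟩
      3 * (P (suc j) + 2 * (2 * b * P j))
        ≡⟨ e₂ b (P j) (P (suc j)) ⟩
      3 * P (suc j) + 12 * (b * P j)
        ≤⟨ ℕ.+-monoˡ-≤ _ le ⟩
      N * 2 * T j + 12 * (b * P j)
        ≡⟨ cong (λ n → n * 2 * T j + 12 * (b * P j)) N≡ ⟩
      (2 * b + c) * 2 * T j + 12 * (b * P j)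
        ≡⟨ e₃ b c (P j) (T j) ⟩
      12 * (b * P j) + 4 * (b * T j) + 2 * c * T j ∎))
      where
      e₁ : ∀ b c p t → 12 * (b * p) + 4 * (b * t) + 2 * c * (3 * p) + 2 * (b * t) ≡ 3 * ((2 * b + c) * 2 * p + 2 * b * t)
      e₁ b c p t = solve (b ∷ c ∷ p ∷ t ∷ [])
      e₂ : ∀ b p p′ → 3 * (p′ + 2 * (2 * b * p)) ≡ 3 * p′ + 12 * (b * p)
      e₂ b p p′ = solve (b ∷ p ∷ p′ ∷ [])
      e₃ : ∀ b c p t → (2 * b + c) * 2 * t + 12 * (b * p) ≡ 12 * (b * p) + 4 * (b * t) + 2 * c * t
      e₃ b c p t = solve (b ∷ c ∷ p ∷ t ∷ [])

    growth : ∀ j → 3 * P j ≤ⁿ T j → j * b * T j ≤ⁿ 3 * (N * P j)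
    growth zero    _  = z≤n
    growth (suc j) le = ℕ.+-cancelʳ-≤ (4 * (N * (b * T j))) _ _ (begin
      suc j * b * (N * 2 * T j) + 4 * (N * (b * T j))
        ≡⟨ e₁ j b N (T j) ⟩
      2 * (N * (j * b * T j)) + 6 * (N * (b * T j))
        ≤⟨ ℕ.+-monoˡ-≤ _ (ℕ.*-monoʳ-≤ 2 (ℕ.*-monoʳ-≤ N (growth j le′))) ⟩
      2 * (N * (3 * (N * P j))) + 6 * (N * (b * T j))
        ≡⟨ e₂ b N (P j) (T j) ⟩
      3 * (N * (N * 2 * P j + 2 * b * T j))
        ≤⟨ ℕ.*-monoʳ-≤ 3 (ℕ.*-monoʳ-≤ N (P-suc j)) ⟩
      3 * (N * (P (suc j) + 2 * (2 * b * P j)))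
        ≡⟨ e₃ b N (P j) (P (suc j)) ⟩
      3 * (N * P (suc j)) + 4 * (N * (b * (3 * P j)))
        -- By p_j ≤ 1/3 the loss 2δp_j is at most 2δ/3, which leaves a gain of δ/3.
        ≤⟨ ℕ.+-monoʳ-≤ (3 * (N * P (suc j))) (ℕ.*-monoʳ-≤ 4 (ℕ.*-monoʳ-≤ N (ℕ.*-monoʳ-≤ b le′))) ⟩
      3 * (N * P (suc j)) + 4 * (N * (b * T j)) ∎)
      where
      le′ = third-pred j le
      e₁ : ∀ j b N t → (b + j * b) * (N * 2 * t) + 4 * (N * (b * t)) ≡ 2 * (N * (j * b * t)) + 6 * (N * (b * t))
      e₁ j b N t = solve (j ∷ b ∷ N ∷ t ∷ [])
      e₂ : ∀ b N p t → 2 * (N * (3 * (N * p))) + 6 * (N * (b * t)) ≡ 3 * (N * (N * 2 * p + 2 * b * t))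
      e₂ b N p t = solve (b ∷ N ∷ p ∷ t ∷ [])
      e₃ : ∀ b N p p′ → 3 * (N * (p′ + 2 * (2 * b * p))) ≡ 3 * (N * p′) + 4 * (N * (b * (3 * p)))
      e₃ b N p p′ = solve (b ∷ N ∷ p ∷ p′ ∷ [])

-- A nearby homomorphism when rejection is rare.

module _ (G H : FiniteGroup) (f : FiniteGroup.Carrier G → FiniteGroup.Carrier H) where
  open FiniteGroup G using () renaming (size to N)
  open Walk G H f
  open Decoded G H f
  open Arithmetic

  -- The inequality reads mδ ≤ 3(ρ + δ), that is ρ ≥ (m - 3)δ/3 kept free of subtraction.
  nearbyHomomorphism : ∀ i m → m ≡ suc i + suc i → 16 * r m <ⁿ T m →
    ∃ λ h → IsHomomorphism G H h × m * bad h * T m ≤ⁿ 3 * (N * r m + T m * bad h)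
  nearbyHomomorphism i m refl small = h , isHomomorphism h homo , (begin
    m * bad h * T m               ≤⟨ growth N (bad h) c N≡ (P h homo) (P-suc h homo) m P-third ⟩
    3 * (N * P h homo m)          ≤⟨ ℕ.*-monoʳ-≤ 3 (P-upper h homo (i + suc i)) ⟩
    3 * (N * r m + T m * bad h)   ∎)
    where
    open ℕ.≤-Reasoning
    decoded = λ x → popular {m} (s≤s (ℕ.≤-trans (s≤s z≤n) (ℕ.m≤n+m (suc i) i))) x
    h = λ x → proj₁ (decoded x)
    close : Popular h m
    close x = proj₂ (decoded x)
    homo : Homo h
    homo = popular⇒homo h m close (ℕ.≤-<-trans (ℕ.*-monoˡ-≤ (r m) (ℕ.m≤m+n 6 10)) small)
    instance
      T-nonZero-m : NonZero (T m)
      T-nonZero-m = T-nonZero m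
    crude : 16 * bad h ≤ⁿ 5 * N
    crude = distance-crude N (T m) (r m) (bad h) (ℕ.<⇒≤ small) (popular⇒near h i close)
    P-third : 3 * P h homo m ≤ⁿ T m
    P-third = ℕ.*-cancelˡ-≤ N (begin
      N * (3 * P h homo m)        ≡⟨ e₁ N (P h homo m) ⟩
      3 * (N * P h homo m)        ≤⟨ ℕ.*-monoʳ-≤ 3 (P-upper h homo (i + suc i)) ⟩
      3 * (N * r m + T m * bad h) ≤⟨ third-bound N (T m) (r m) (bad h) (ℕ.<⇒≤ small)
                                       (distance-fine N (T m) (r m) (bad h) crude (popular⇒quadratic h homo m close)) ⟩
      N * T m                     ∎)
      where
      e₁ : ∀ n p → n * (3 * p) ≡ 3 * (n * p)
      e₁ n p = solve (n ∷ p ∷ [])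
    -- 16δ ≤ 5 < 8, so 1 - 2δ is positive as `growth` demands.
    2bad<N : 2 * bad h <ⁿ N
    2bad<N = ℕ.*-cancelˡ-< 8 _ _ (ℕ.≤-<-trans (ℕ.≤-trans (ℕ.≤-reflexive (sym (ℕ.*-assoc 8 2 (bad h)))) crude)
                                             (ℕ.*-monoˡ-< N (ℕ.m≤m+n 6 2)))
    c = N ∸ 2 * bad h
    instance
      c-nonZero : NonZero c
      c-nonZero = >-nonZero (ℕ.m<n⇒0<n∸m 2bad<N)
    N≡ : N ≡ 2 * bad h + c
    N≡ = sym (ℕ.m+[n∸m]≡n (ℕ.<⇒≤ 2bad<N))

-- Passage to rational probabilities.

open import Data.Integer using (+_; _-_)
open import Data.Rational using (ℚ; _/_; _<_; _≤_; _⊓_; 0ℚ; 1ℚ)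
open import Data.Rational using () renaming (_*_ to _*ℚ_)

import Data.Integer as ℤ
import Data.Integer.Properties as ℤ
open import Data.Rational using (toℚᵘ; NonPositive; nonNegative)
import Data.Rational.Properties as ℚ
open import Data.Rational.Unnormalised as ℚᵘ using (mkℚᵘ)
import Data.Rational.Unnormalised.Properties as ℚᵘ

-- `_/_` reduces to lowest terms; on unnormalised rationals the order is plain cross-multiplication.
frac-mono : ∀ {a b c d} .{{_ : NonZero b}} .{{_ : NonZero d}} → a * d ≤ⁿ c * b → frac a b ≤ frac c d
frac-mono {a} {suc b} {c} {suc d} le = ℚ.toℚᵘ-cancel-≤ (begin
  toℚᵘ (+ a / suc b)  ≃⟨ ℚ.toℚᵘ-fromℚᵘ (mkℚᵘ (+ a) b) ⟩
  mkℚᵘ (+ a) b        ≤⟨ ℚᵘ.*≤* (subst₂ ℤ._≤_ (ℤ.pos-* a (suc d)) (ℤ.pos-* c (suc b)) (ℤ.+≤+ le)) ⟩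
  mkℚᵘ (+ c) d        ≃⟨ ℚ.toℚᵘ-fromℚᵘ (mkℚᵘ (+ c) d) ⟨
  toℚᵘ (+ c / suc d)  ∎)
  where open ℚᵘ.≤-Reasoning

frac-* : ∀ a b c d .{{_ : NonZero b}} .{{_ : NonZero d}} → frac a b *ℚ frac c d ≡ frac (a * c) (b * d)
frac-* a (suc b) c (suc d) = ℚ.toℚᵘ-injective (begin
  toℚᵘ ((+ a / suc b) *ℚ (+ c / suc d))             ≈⟨ ℚ.toℚᵘ-homo-* (+ a / suc b) (+ c / suc d) ⟩
  toℚᵘ (+ a / suc b) ℚᵘ.* toℚᵘ (+ c / suc d)        ≈⟨ ℚᵘ.*-cong (ℚ.toℚᵘ-fromℚᵘ (mkℚᵘ (+ a) b)) (ℚ.toℚᵘ-fromℚᵘ (mkℚᵘ (+ c) d)) ⟩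
  mkℚᵘ (+ a) b ℚᵘ.* mkℚᵘ (+ c) d                    ≡⟨ cong (λ n → mkℚᵘ n (d + b * suc d)) (ℤ.pos-* a c) ⟨
  mkℚᵘ (+ (a * c)) (d + b * suc d)                  ≈⟨ ℚ.toℚᵘ-fromℚᵘ (mkℚᵘ (+ (a * c)) (d + b * suc d)) ⟨
  toℚᵘ (+ (a * c) / suc (d + b * suc d))            ∎)
  where open import Relation.Binary.Reasoning.Setoid ℚᵘ.≃-setoid

frac-nonNegative : ∀ a b .{{_ : NonZero b}} → 0ℚ ≤ frac a b
frac-nonNegative a b = frac-mono {0} {1} {a} {b} z≤n

-- Covers k = 0 and k = 1, where 2k - 3 is negative and the claimed bound is at most 0.
nonPositive-⊓ : ∀ q ε x {p} .{{_ : NonPositive q}} → 0ℚ < ε → 0ℚ ≤ p → (q *ℚ ε) ⊓ x ≤ p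
nonPositive-⊓ q ε x {p} 0<ε 0≤p = begin
  (q *ℚ ε) ⊓ x ≤⟨ ℚ.p⊓q≤p (q *ℚ ε) x ⟩
  q *ℚ ε       ≤⟨ ℚ.*-monoˡ-≤-nonPos q (ℚ.<⇒≤ 0<ε) ⟩
  q *ℚ 0ℚ      ≡⟨ ℚ.*-zeroʳ q ⟩
  0ℚ           ≤⟨ 0≤p ⟩
  p            ∎
  where open ℚ.≤-Reasoning

theorem3p1 : (k : ℕ) (ε : ℚ) → 0ℚ < ε → ε < 1ℚ
    → (G H : FiniteGroup) (f : FiniteGroup.Carrier G → FiniteGroup.Carrier H)
    → εFar ε G H f
    → ((((+ (2 * k)) - (+ 3)) / 3) *ℚ ε) ⊓ ((+ 1) / 16) ≤ rejectProb (2 * k) G H f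
theorem3p1 k ε 0<ε _ G H f far =
  subst (((((+ (2 * k)) - (+ 3)) / 3) *ℚ ε) ⊓ ((+ 1) / 16) ≤_) (sym (rejectProb≡ (2 * k))) (bound k)
  where
  open FiniteGroup G using () renaming (elements to E; size to N)
  open Walk G H f
  open Decoded G H f using (bad)
  open Counting G H f using (rejectProb≡)
  open ℚ.≤-Reasoning

  p : ℕ → ℚ
  p m = frac (r m) (T m)

  p≥0 : ∀ m → 0ℚ ≤ p m
  p≥0 m = frac-nonNegative (r m) (T m) {{T-nonZero m}}

  disagreement≡ : ∀ h → disagreement G H f h ≡ frac (bad h) N
  disagreement≡ h = cong (λ n → frac n N) (length-filter-∑ (λ x → ¬? (FiniteGroup._≟_ H (f x) (h x))) E)

  highRejection : ∀ m q → T m ≤ⁿ 16 * r m → q ⊓ ((+ 1) / 16) ≤ p m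
  highRejection m q T≤16r = begin
    q ⊓ ((+ 1) / 16) ≤⟨ ℚ.p⊓q≤q q ((+ 1) / 16) ⟩
    frac 1 16        ≤⟨ frac-mono {1} {16} {r m} {T m} {{_}} {{T-nonZero m}} 1*T≤r*16 ⟩
    p m              ∎
    where
    1*T≤r*16 : 1 * T m ≤ⁿ r m * 16
    1*T≤r*16 = subst₂ _≤ⁿ_ (sym (ℕ.*-identityˡ (T m))) (ℕ.*-comm 16 (r m)) T≤16r

  -- Farness enters here: since `h` is a homomorphism, δ > ε.
  lowRejection : ∀ m h → IsHomomorphism G H h → 3 ≤ⁿ m → m * bad h * T m ≤ⁿ 3 * (N * r m + T m * bad h) →
                 (((+ m) - (+ 3)) / 3) *ℚ ε ≤ p m
  lowRejection m h isHom 3≤m m*bad*T≤ = begin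
    (((+ m) - (+ 3)) / 3) *ℚ ε        ≡⟨ cong (λ n → (n / 3) *ℚ ε) (trans (ℤ.m-n≡m⊖n m 3) (ℤ.⊖-≥ 3≤m)) ⟩
    frac (m ∸ 3) 3 *ℚ ε               ≤⟨ ℚ.*-monoˡ-≤-nonNeg (frac (m ∸ 3) 3) {{nonNegative (frac-nonNegative (m ∸ 3) 3)}}
                                           (ℚ.<⇒≤ (subst (ε <_) (disagreement≡ h) (far h isHom))) ⟩
    frac (m ∸ 3) 3 *ℚ frac (bad h) N  ≡⟨ frac-* (m ∸ 3) 3 (bad h) N ⟩
    frac ((m ∸ 3) * bad h) (3 * N)    ≤⟨ frac-mono {(m ∸ 3) * bad h} {3 * N} {r m} {T m} {{ℕ.m*n≢0 3 N}} {{T-nonZero m}} cleared ⟩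
    p m                               ∎
    where
    cleared : (m ∸ 3) * bad h * T m ≤ⁿ r m * (3 * N)
    -- Adding the term for 3δ on both sides turns `m ∸ 3` back into `m`; `3 ≤ m` rules out
    -- truncation.
    cleared = ℕ.+-cancelʳ-≤ (3 * (T m * bad h)) _ _ (subst₂ _≤ⁿ_
      (trans (cong (λ n → n * bad h * T m) (sym (ℕ.m∸n+n≡m 3≤m))) (e₁ (m ∸ 3) (bad h) (T m)))
      (e₂ N (r m) (T m) (bad h)) m*bad*T≤)
      where
      e₁ : ∀ a b t → (a + 3) * b * t ≡ a * b * t + 3 * (t * b)
      e₁ a b t = solve (a ∷ b ∷ t ∷ [])
      e₂ : ∀ n r t b → 3 * (n * r + t * b) ≡ r * (3 * n) + 3 * (t * b)
      e₂ n r t b = solve (n ∷ r ∷ t ∷ b ∷ [])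

  bound≥3 : ∀ i m → m ≡ suc i + suc i → 3 ≤ⁿ m → ((((+ m) - (+ 3)) / 3) *ℚ ε) ⊓ ((+ 1) / 16) ≤ p m
  bound≥3 i m m≡ 3≤m = [ highRejection m ((((+ m) - (+ 3)) / 3) *ℚ ε) , near ]′ (ℕ.≤-<-connex (T m) (16 * r m))
    where
    near : 16 * r m <ⁿ T m → ((((+ m) - (+ 3)) / 3) *ℚ ε) ⊓ ((+ 1) / 16) ≤ p m
    near 16r<T = let h , isHom , m*bad*T≤ = nearbyHomomorphism G H f i m m≡ 16r<T in
      ℚ.≤-trans (ℚ.p⊓q≤p ((((+ m) - (+ 3)) / 3) *ℚ ε) ((+ 1) / 16)) (lowRejection m h isHom 3≤m m*bad*T≤)

  bound : ∀ k → ((((+ (2 * k)) - (+ 3)) / 3) *ℚ ε) ⊓ ((+ 1) / 16) ≤ p (2 * k)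
  bound 0 = nonPositive-⊓ (((+ 0) - (+ 3)) / 3) ε _ 0<ε (p≥0 0)
  bound 1 = nonPositive-⊓ (((+ 2) - (+ 3)) / 3) ε _ 0<ε (p≥0 2)
  bound (suc (suc i)) = bound≥3 (suc i) (2 * suc (suc i)) (cong (λ n → suc (suc i) + n) (ℕ.+-identityʳ _))
    (ℕ.≤-trans (ℕ.m≤m+n 3 1) (ℕ.*-monoʳ-≤ 2 (s≤s (s≤s z≤n))))
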